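{- Let $1\le k\le n$ be integers. The equivalence classes of labeled rooted forests contained in $\mathrm{RF}_{n+1,k}$ are obtained from those contained in $\mathrm{RF}_{n,k}$ by adding a single edge and leaf to $v_f$ for each $f\in\mathrm{RF}_{n,k}$. That is, for $f\in\mathrm{RF}_n$ let $f^{+}\in\mathrm{RF}_{n+1}$ be the forest obtained from $f$ by attaching to the vertex $v_f$ a new child labeled $n+1$; then the set of equivalence classes (under $\sim$) contained in $\mathrm{RF}_{n+1,k}$ is exactly the set of equivalence classes of the forests $f^{+}$ with $f\in\mathrm{RF}_{n,k}$.
   Context: Parking functions. A parking function of length $n$ is an $n$-tuple $(a_1,\dots,a_n)$ of positive integers whose weakly increasing rearrangement $b_1\le\dots\le b_n$ satisfies $b_i\le i$ for all $i$; $\mathrm{PF}_n$ is the set of these. For $1<k\le n$, $\mathrm{PF}_{n,k}$ is the set of $a\in\mathrm{PF}_n$ such that $k$ is not an entry of $a$ but each of $k+1,\dots,n$ is an entry of $a$. The remaining elements of $\mathrm{PF}_n$ are the permutations of $(1,\dots,n)$. Forests. A rooted forest is a collection of trees, each with one vertex designated as its root. $\mathrm{RF}_n$ is the set of rooted forests on $n$ vertices whose vertices are labeled bijectively by $\{1,\dots,n\}$. For a vertex $v$, $h(v)$ is the distance from $v$ to the root of its tree; if $v,w$ are adjacent and $h(w)=h(v)+1$, then $v$ is the parent of $w$ and $w$ is a child of $v$. Two distinct vertices are siblings if they have the same parent or are both roots. $\eta(v)=i$ if $v$ has the $i$-th smallest label among the set consisting of $v$ and its siblings. $P_f$ is the unique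 path in $f$ from a root to a leaf (a vertex with no children) all of whose vertices $v$ satisfy $\eta(v)=1$, and $v_f$ is the leaf at its end. Two forests $f_1,f_2\in\mathrm{RF}_n$ are equivalent, $f_1\sim f_2$, if there is a graph isomorphism $\psi:f_1\to f_2$ with $h(\psi(v))=h(v)$ and $\eta(\psi(v))=\eta(v)$ for all vertices $v$ of $f_1$. Bijection $\phi:\mathrm{RF}_n\to\mathrm{PF}_n$. Given $f\in\mathrm{RF}_n$, form a labeled binary rooted tree $b$ with the same labeled vertices: the root of $b$ is the root of $f$ with $\eta=1$; the left child in $b$ of a vertex $v$ is the sibling $w$ of $v$ in $f$ with $\eta(w)=\eta(v)+1$, if it exists; the right child in $b$ of $v$ is the child $x$ of $v$ in $f$ with $\eta(x)=1$, if it exists. Walk counterclockwise around the outside of $b$ starting at its root: at the first encounter with a vertex record an up step labeled by that vertex; if the vertex has a left child, record a right step when the vertex is encountered for the second time (after going around its left subtree); otherwise record the right step immediately after the up step. (Recursively, the word of a subtree with root $v$, left subtree $L$ and right subtree $R$ is $U_v\,D(L)\,\mathrm{(right)}\,D(R)$, where $D$ of the empty tree is empty.) This gives a labeled Dyck path, and $\phi(f)=(a_1,\dots,a_n)$ where $a_i$ is $1$ plus the number of right steps preceding the up step labeled $i$. The map $\phi$ is a bijection. For $1<k\le n$, $\mathrm{RF}_{n,k}=\phi^{ -1}(\mathrm{PF}_{n,k})$, and $\mathrm{RF}_{n,1}$ is the set of $f\in\mathrm{RF}_n$ such that $\phi(f)$ is a permutation of $(1,\dots,n)$. Each $\mathrm{RF}_{n,k}$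 is a union of equivalence classes. -}

module Defs where

open import Level using (0ℓ)
open import Data.Empty using (⊥-elim)
open import Data.Fin as Fin using (Fin; zero; suc; toℕ; fromℕ; inject₁)
import Data.Fin.Properties as Fin
open import Data.Fin.Permutation using (Permutation′; _⟨$⟩ʳ_)
open import Data.Fin.Relation.Unary.Top using (view; ‵fromℕ; ‵inject₁)
open import Data.List using (List; []; _∷_; _++_; [_]; length; filter; map; allFin)
open import Data.List.Membership.Propositional using (_∈_; _∉_)
open import Data.List.Membership.Propositional.Properties using (∈-filter⁺; ∈-allFin)
open import Data.List.Properties using (length-++; filter-none; map-++; length-map)
open import Data.List.Relation.Unary.All as All using (All; []; _∷_)
import Data.List.Relation.Unary.All.Properties as All
open import Data.List.Relation.Unary.Any as Any using (here; there)
open import Data.List.Relation.Unary.AllPairs using ([]; _∷_)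
open import Data.List.Relation.Unary.Linked as Linked using (Linked; []; [-]; _∷_)
import Data.List.Relation.Unary.Linked.Properties as Linked
open import Data.List.Relation.Unary.Unique.Propositional using (Unique)
import Data.List.Relation.Unary.Unique.Propositional.Properties as Unique
open import Data.Maybe as Maybe using (Maybe; just; nothing)
open import Data.Nat using (ℕ; zero; suc; _+_; _≤_; _<_; z≤n; s≤s; s≤s⁻¹; NonZero)
open import Data.Nat.Properties as ℕ using (_≟_)
open import Data.Product using (∃; ∃!; _×_; _,_; proj₁; proj₂)
open import Data.Sum using (_⊎_; inj₁; inj₂)
open import Data.Tree.Binary using (Tree; leaf; node)
open import Data.Unit using (⊤; tt)
open import Data.Vec.Functional using (Vector)
open import Data.Vec.Functional.Relation.Binary.Permutation using (_↭_)
open import Function using (_∘_; _⇔_)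
open import Relation.Binary using (Rel; Decidable; tri<; tri≈; tri>)
open import Relation.Binary.PropositionalEquality hiding ([_])
open import Relation.Nullary using (¬_; yes; no; contradiction; ¬?)
open import Relation.Nullary.Decidable using (_×-dec_; _⊎-dec_; map′; dec⇒maybe)
import Relation.Unary as U
open U using (Pred)

minimal : {P : Pred ℕ 0ℓ} → U.Decidable P → ∀ m → P m →
          ∃ λ d → P d × (∀ {e} → P e → d ≤ e)
minimal P? m pm with P? 0
... | yes p₀ = 0 , p₀ , λ _ → z≤n
minimal     P? zero    pm | no ¬p₀ = contradiction pm ¬p₀
minimal {P} P? (suc m) pm | no ¬p₀
  with d , pd , least ← minimal {P ∘ suc} (P? ∘ suc) m pm =
  suc d , pd , λ { {zero} p₀ → contradiction p₀ ¬p₀ ; {suc e} pe → s≤s (least pe) }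

minimalFin : ∀ {n} {P : Pred (Fin n) 0ℓ} → U.Decidable P → ∃ P →
             ∃ λ i → P i × (∀ {j} → P j → i Fin.≤ j)
minimalFin {suc n} P? (i , pi) with P? zero
... | yes p₀ = zero , p₀ , λ _ → z≤n
minimalFin         P? (zero  , pi) | no ¬p₀ = contradiction pi ¬p₀
minimalFin {P = P} P? (suc i , pi) | no ¬p₀
  with k , pk , least ← minimalFin {P = P ∘ suc} (P? ∘ suc) (i , pi) =
  suc k , pk , λ { {zero} p₀ → contradiction p₀ ¬p₀ ; {suc j} pj → s≤s (least pj) }

------------------------------------------------------------------------
-- Graphs and rooted forests

-- The vertex i : Fin n carries the label suc (toℕ i), so that the labels
-- are 1, …, n and the order on Fin n is the order of labels.

record Graph (n : ℕ) : Set₁ where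
  infix 4 _—_ _—?_
  field
    _—_    : Rel (Fin n) 0ℓ
    _—?_   : Decidable _—_
    —-sym  : ∀ {u v} → u — v → v — u
    —-irr  : ∀ {v} → ¬ (v — v)

  Walk : ℕ → Rel (Fin n) 0ℓ
  Walk zero    u v = u ≡ v
  Walk (suc d) u v = ∃ λ w → u — w × Walk d w v

  walk? : ∀ d → Decidable (Walk d)
  walk? zero    u v = u Fin.≟ v
  walk? (suc d) u v = Fin.any? λ w → (u —? w) ×-dec walk? d w v

  Connected : Rel (Fin n) 0ℓ
  Connected u v = ∃ λ d → Walk d u v

  dist : ∀ {u v} → Connected u v → ℕ
  dist {u} {v} (d , w) = proj₁ (minimal (λ e → walk? e u v) d w)

  -- v ∷ ws lists the vertices of a cycle in cyclic order.
  Acyclic : Set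
  Acyclic = ∀ {v ws} → Unique (v ∷ ws) → 2 ≤ length ws →
            ¬ Linked _—_ (v ∷ ws ++ [ v ])

-- A disjoint union of trees, one root in each: an acyclic graph with
-- exactly one root in every connected component.

record RF (n : ℕ) : Set₁ where
  field
    graph   : Graph n
  open Graph graph public
  field
    Root    : Pred (Fin n) 0ℓ
    root?   : U.Decidable Root
    acyclic : Acyclic
    rooted  : ∀ v → ∃! _≡_ λ r → Root r × Connected v r

  rootOf : Fin n → Fin n
  rootOf v = proj₁ (rooted v)

  toRoot : ∀ v → Connected v (rootOf v)
  toRoot v = proj₂ (proj₁ (proj₂ (rooted v)))

  h : Fin n → ℕ
  h v = dist (toRoot v)

  Parent : Rel (Fin n) 0ℓ
  Parent v w = v — w × h w ≡ suc (h v)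

  parent? : Decidable Parent
  parent? v w = (v —? w) ×-dec (h w ≟ suc (h v))

  Sibling : Rel (Fin n) 0ℓ
  Sibling v w = v ≢ w × ((∃ λ p → Parent p v × Parent p w) ⊎ (Root v × Root w))

  sibling? : Decidable Sibling
  sibling? v w = ¬? (v Fin.≟ w) ×-dec
    (Fin.any? (λ p → parent? p v ×-dec parent? p w) ⊎-dec (root? v ×-dec root? w))

  smallerSiblings : Fin n → List (Fin n)
  smallerSiblings v = filter (λ w → sibling? v w ×-dec (w Fin.<? v)) (allFin n)

  η : Fin n → ℕ
  η v = suc (length (smallerSiblings v))

  Leaf : Pred (Fin n) 0ℓ
  Leaf v = ∀ w → ¬ Parent v w

  -- Vertices reached from a root by steps to children through vertices
  -- with η = 1 only.
  data OnFirstPath : Pred (Fin n) 0ℓ where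
    start : ∀ {r} → Root r → η r ≡ 1 → OnFirstPath r
    step  : ∀ {v w} → OnFirstPath v → Parent v w → η w ≡ 1 → OnFirstPath w

  EndOfFirstPath : Pred (Fin n) 0ℓ
  EndOfFirstPath v = OnFirstPath v × Leaf v

------------------------------------------------------------------------
-- Existence and uniqueness of the end of the first path

Linked-∷ʳ : ∀ {A : Set} {R : Rel A 0ℓ} {y z} xs →
            Linked R (xs ++ [ y ]) → R y z → Linked R ((xs ++ [ y ]) ++ [ z ])
Linked-∷ʳ []           [-]      r = r ∷ [-]
Linked-∷ʳ (x ∷ [])     (s ∷ ss) r = s ∷ Linked-∷ʳ [] ss r
Linked-∷ʳ (x ∷ y ∷ xs) (s ∷ ss) r = s ∷ Linked-∷ʳ (y ∷ xs) ss r

Unique-∷ʳ : ∀ {A : Set} {xs : List A} {y} →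
            Unique xs → All (_≢ y) xs → Unique (xs ++ [ y ])
Unique-∷ʳ []       []       = [] ∷ []
Unique-∷ʳ (p ∷ ps) (q ∷ qs) = All.∷ʳ⁺ p q ∷ Unique-∷ʳ ps qs

bounded : ∀ {n} (g : Fin n → ℕ) → ∃ λ b → ∀ i → g i ≤ b
bounded {zero}  g = 0 , λ ()
bounded {suc n} g with b , g≤b ← bounded (g ∘ suc) =
  g zero + b , λ { zero    → ℕ.m≤m+n _ _
                 ; (suc i) → ℕ.≤-trans (g≤b i) (ℕ.m≤n+m _ _) }

module _ {n} (f : RF n) where
  open RF f

  rootOf-unique : ∀ {v r} → Root r → Connected v r → rootOf v ≡ r
  rootOf-unique {v} rr c = proj₂ (proj₂ (rooted v)) (rr , c)

  rootOf-root : ∀ v → Root (rootOf v)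
  rootOf-root v = proj₁ (proj₁ (proj₂ (rooted v)))

  h-minimal : ∀ v → ∃ λ d → Walk d v (rootOf v) ×
                            (∀ {e} → Walk e v (rootOf v) → d ≤ e)
  h-minimal v = minimal (λ e → walk? e v (rootOf v)) (proj₁ (toRoot v)) (proj₂ (toRoot v))

  h-walk : ∀ v → Walk (h v) v (rootOf v)
  h-walk v = proj₁ (proj₂ (h-minimal v))

  h-least : ∀ v {d} → Walk d v (rootOf v) → h v ≤ d
  h-least v = proj₂ (proj₂ (h-minimal v))

  h-root : ∀ {r} → Root r → h r ≡ 0
  h-root {r} rr = ℕ.n≤0⇒n≡0 (h-least r (sym (rootOf-unique rr (0 , refl))))

  rootOf-adj : ∀ {u v} → u — v → rootOf u ≡ rootOf v
  rootOf-adj {u} {v} e with d , w ← toRoot v =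
    rootOf-unique (rootOf-root v) (suc d , v , e , w)

  h≡0⇒root : ∀ {v} → h v ≡ 0 → v ≡ rootOf v
  h≡0⇒root {v} eq = subst (λ d → Walk d v (rootOf v)) eq (h-walk v)

  parent-exists : ∀ {v d} → h v ≡ suc d →
                  ∃ λ p → p — v × h p ≡ d × rootOf p ≡ rootOf v
  parent-exists {v} {d} eq
    with p , e , w ← subst (λ d → Walk d v (rootOf v)) eq (h-walk v) =
    p , —-sym e , ℕ.≤-antisym (h-least p (subst (Walk d p) same w)) d≤hp , sym same
    where
    same : rootOf v ≡ rootOf p
    same = rootOf-adj e
    d≤hp : d ≤ h p
    d≤hp = s≤s⁻¹ (subst (_≤ suc (h p)) eq
      (h-least v (p , e , subst (Walk (h p) p) (sym same) (h-walk p))))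

  level-path : ∀ d {u v} → h u ≡ d → h v ≡ d → rootOf u ≡ rootOf v → u ≢ v →
               ∃ λ ws → Linked _—_ (u ∷ ws ++ [ v ]) × Unique (u ∷ ws ++ [ v ])
                      × All (λ x → h x ≤ d) (u ∷ ws ++ [ v ])
  level-path zero hu hv same u≢v =
    contradiction (trans (h≡0⇒root hu) (trans same (sym (h≡0⇒root hv)))) u≢v
  level-path (suc d) {u} {v} hu hv same u≢v
    with p , pu , hp , rp ← parent-exists hu
       | q , qv , hq , rq ← parent-exists hv
    with p Fin.≟ q
  ... | yes refl = [ p ] , —-sym pu ∷ qv ∷ [-]
      , ((λ { refl → ℕ.1+n≢n (trans (sym hu) hp) }) ∷ u≢v ∷ [])
        ∷ ((λ { refl → ℕ.1+n≢n (trans (sym hv) hp) }) ∷ []) ∷ [] ∷ []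
      , ℕ.≤-reflexive hu ∷ ℕ.m≤n⇒m≤1+n (ℕ.≤-reflexive hp) ∷ ℕ.≤-reflexive hv ∷ []
  ... | no p≢q
    with ws , l , un , lo ← level-path d hp hq (trans rp (trans same (sym rq))) p≢q
    = p ∷ ws ++ [ q ]
    , —-sym pu ∷ Linked-∷ʳ (p ∷ ws) l qv
    , All.∷ʳ⁺ (All.map (≢-above hu) lo) u≢v
      ∷ Unique-∷ʳ un (All.map (λ le eq → ≢-above hv le (sym eq)) lo)
    , ℕ.≤-reflexive hu ∷ All.∷ʳ⁺ (All.map ℕ.m≤n⇒m≤1+n lo) (ℕ.≤-reflexive hv)
    where
    ≢-above : ∀ {x y} → h x ≡ suc d → h y ≤ d → x ≢ y
    ≢-above hx hy refl = ℕ.1+n≰n (subst (_≤ d) hx hy)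

  parent-unique : ∀ {u v w} → Parent u w → Parent v w → u ≡ v
  parent-unique {u} {v} {w} (uw , hu) (vw , hv) with u Fin.≟ v
  ... | yes u≡v = u≡v
  ... | no u≢v
    with ws , l , un , lo ← level-path (h u) refl (ℕ.suc-injective (trans (sym hv) hu))
                              (trans (rootOf-adj uw) (sym (rootOf-adj vw))) u≢v
    = ⊥-elim (acyclic
        (All.map (λ le → λ { refl → ℕ.1+n≰n (subst (_≤ h u) hu le) }) lo ∷ un)
        (s≤s (subst (1 ≤_) (sym (length-++ ws)) (ℕ.m≤n+m 1 (length ws))))
        (—-sym uw ∷ Linked-∷ʳ (u ∷ ws) l vw))

  root-no-parent : ∀ {r p} → Root r → ¬ Parent p r
  root-no-parent rr (_ , hr) with () ← trans (sym (h-root rr)) hr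

  sibling-sym : ∀ {u v} → Sibling u v → Sibling v u
  sibling-sym (u≢v , inj₁ (p , pu , pv)) = u≢v ∘ sym , inj₁ (p , pv , pu)
  sibling-sym (u≢v , inj₂ (ru , rv))     = u≢v ∘ sym , inj₂ (rv , ru)

  η≡1 : ∀ {v} → (∀ {w} → Sibling v w → v Fin.≤ w) → η v ≡ 1
  η≡1 least = cong (suc ∘ length) (filter-none _
    (All.universal (λ w (s , w<v) → ℕ.<⇒≱ w<v (least s)) (allFin n)))

  η≡1⇒≤ : ∀ {v w} → η v ≡ 1 → Sibling v w → ¬ w Fin.< v
  η≡1⇒≤ {v} {w} eq s w<v
    with smallerSiblings v
       | ∈-filter⁺ (λ w → sibling? v w ×-dec (w Fin.<? v)) (∈-allFin w) (s , w<v)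
  η≡1⇒≤ () s w<v | _ ∷ _ | _

  η≡1-unique : ∀ {v w} → η v ≡ 1 → η w ≡ 1 →
               (∃ λ p → Parent p v × Parent p w) ⊎ (Root v × Root w) → v ≡ w
  η≡1-unique {v} {w} ev ew s with Fin.<-cmp v w
  ... | tri≈ _ v≡w _ = v≡w
  ... | tri< v<w v≢w _ = contradiction v<w (η≡1⇒≤ ew (sibling-sym (v≢w , s)))
  ... | tri> _ v≢w w<v = contradiction w<v (η≡1⇒≤ ev (v≢w , s))

  firstRoot : .{{NonZero n}} → ∃ λ r → Root r × η r ≡ 1
  firstRoot = go (someVertex n)
    where
    someVertex : ∀ m .{{_ : NonZero m}} → Fin m
    someVertex (suc m) = zero
    go : Fin n → ∃ λ r → Root r × η r ≡ 1
    go v with r , rr , least ← minimalFin root? (rootOf v , rootOf-root v) =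
      r , rr , η≡1 λ { (_ , inj₁ (p , pr , _)) → contradiction pr (root-no-parent rr)
                     ; (_ , inj₂ (_ , rw)) → least rw }

  firstChild : ∀ {v w} → Parent v w → ∃ λ x → Parent v x × η x ≡ 1
  firstChild {v} {w} vw with x , vx , least ← minimalFin (parent? v) (w , vw) =
    x , vx , η≡1 λ { (_ , inj₁ (p , px , py)) →
                       least (subst (λ p → Parent p _) (parent-unique px vx) py)
                   ; (_ , inj₂ (rx , _)) → contradiction vx (root-no-parent rx) }

  -- b bounds the height still available above v.
  descend : ∀ b {v} → (∀ w → h w ≤ b + h v) → OnFirstPath v → ∃ EndOfFirstPath
  descend b {v} hi on with Fin.any? (parent? v)
  ... | no ¬child = v , on , λ w vw → ¬child (w , vw)
  descend zero    {v} hi on | yes (w , _ , hw) =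
    contradiction (subst (_≤ h v) hw (hi w)) ℕ.1+n≰n
  descend (suc b) {v} hi on | yes (w , vw)
    with x , vx , ex ← firstChild vw =
    descend b (λ w → subst (h w ≤_)
                (trans (sym (ℕ.+-suc b (h v))) (cong (b +_) (sym (proj₂ vx)))) (hi w))
              (step on vx ex)

  level-unique : ∀ {v w} → OnFirstPath v → OnFirstPath w → h v ≡ h w → v ≡ w
  level-unique (start rv ev) (start rw ew) _ = η≡1-unique ev ew (inj₂ (rv , rw))
  level-unique (start rv _) (step _ (_ , hw) _) eq
    with () ← trans (sym (h-root rv)) (trans eq hw)
  level-unique (step _ (_ , hv) _) (start rw _) eq
    with () ← trans (sym (h-root rw)) (trans (sym eq) hv)
  level-unique (step on pv ev) (step on′ qw ew) eq
    with refl ← level-unique on on′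
                  (ℕ.suc-injective (trans (sym (proj₂ pv)) (trans eq (proj₂ qw)))) =
    η≡1-unique ev ew (inj₁ (_ , pv , qw))

  not-below : ∀ {v w} → EndOfFirstPath v → OnFirstPath w → ¬ h v < h w
  not-below end (start rw _) lt = ℕ.n≮0 (subst (_ <_) (h-root rw) lt)
  not-below {v} end@(on , leaf-v) (step {u} on′ uw _) lt with h v ≟ h u
  ... | yes eq with refl ← level-unique on on′ eq = leaf-v _ uw
  ... | no neq = not-below end on′
                   (ℕ.≤∧≢⇒< (s≤s⁻¹ (subst (h v <_) (proj₂ uw) lt)) neq)

  endOfFirstPath : .{{NonZero n}} → ∃! _≡_ EndOfFirstPath
  endOfFirstPath
    with r , rr , er ← firstRoot
       | b , h≤b ← bounded h
    with v , end ← descend b (λ w → ℕ.≤-trans (h≤b w) (ℕ.m≤m+n b (h r))) (start rr er) =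
    v , end , λ {w} end′ → level-unique (proj₁ end) (proj₁ end′)
      (ℕ.≤-antisym (ℕ.≮⇒≥ (not-below end′ (proj₁ end))) (ℕ.≮⇒≥ (not-below end (proj₁ end′))))

lastVertex : ∀ {n} → RF n → .{{NonZero n}} → Fin n
lastVertex f = proj₁ (endOfFirstPath f)

------------------------------------------------------------------------
-- Attaching a new vertex, with the largest label, below a vertex v

module Attach {n} (f : RF n) (v : Fin n) where
  open RF f

  data Edge : Rel (Fin (suc n)) 0ℓ where
    old  : ∀ {x y} → x — y → Edge (inject₁ x) (inject₁ y)
    down : Edge (inject₁ v) (fromℕ n)
    up   : Edge (fromℕ n) (inject₁ v)

  data IsRoot : Pred (Fin (suc n)) 0ℓ where
    old : ∀ {r} → Root r → IsRoot (inject₁ r)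

  new : Fin (suc n)
  new = fromℕ n

  new≢old : ∀ {x} → new ≢ inject₁ x
  new≢old = Fin.fromℕ≢inject₁

  old-inv : ∀ {x y a b} → a ≡ inject₁ x → b ≡ inject₁ y → Edge a b → x — y
  old-inv p q (old e) =
    subst₂ _—_ (Fin.inject₁-injective p) (Fin.inject₁-injective q) e
  old-inv p q down = contradiction q new≢old
  old-inv p q up   = contradiction p new≢old

  new-inv : ∀ {a b} → b ≡ new → Edge a b → a ≡ inject₁ v
  new-inv p (old _) = contradiction (sym p) new≢old
  new-inv p down    = refl
  new-inv p up      = contradiction (sym p) new≢old

  edge-sym : ∀ {a b} → Edge a b → Edge b a
  edge-sym (old e) = old (—-sym e)
  edge-sym down    = up
  edge-sym up      = down

  edge-irr : ∀ {a b} → a ≡ b → ¬ Edge a b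
  edge-irr p (old {x} e) =
    —-irr (subst (x —_) (sym (Fin.inject₁-injective p)) e)
  edge-irr p down = new≢old (sym p)
  edge-irr p up   = new≢old p

  edge? : Decidable Edge
  edge? a b with view a | view b
  ... | ‵inject₁ x | ‵inject₁ y = map′ old (old-inv refl refl) (x —? y)
  ... | ‵inject₁ x | ‵fromℕ =
    map′ (λ { refl → down }) (Fin.inject₁-injective ∘ new-inv refl) (x Fin.≟ v)
  ... | ‵fromℕ | ‵inject₁ y =
    map′ (λ { refl → up }) (Fin.inject₁-injective ∘ new-inv refl ∘ edge-sym) (y Fin.≟ v)
  ... | ‵fromℕ | ‵fromℕ = no (edge-irr refl)

  isRoot? : U.Decidable IsRoot
  isRoot? a with view a
  ... | ‵inject₁ x = map′ old (inv refl) (root? x)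
    where
    inv : ∀ {a} → a ≡ inject₁ x → IsRoot a → Root x
    inv p (old r) = subst Root (Fin.inject₁-injective p) r
  ... | ‵fromℕ = no (inv refl)
    where
    inv : ∀ {a} → a ≡ new → ¬ IsRoot a
    inv p (old r) = new≢old (sym p)

  newGraph : Graph (suc n)
  newGraph = record
    { _—_ = Edge ; _—?_ = edge? ; —-sym = edge-sym ; —-irr = edge-irr refl }

  module G = Graph newGraph

  old-list : ∀ as → new ∉ as → ∃ λ xs → as ≡ map inject₁ xs
  old-list []       _ = [] , refl
  old-list (a ∷ as) new∉ with view a | old-list as (new∉ ∘ there)
  ... | ‵fromℕ     | _         = contradiction (here refl) new∉
  ... | ‵inject₁ x | xs , refl = x ∷ xs , refl

  -- The two neighbours of an occurrence of the new vertex coincide.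
  no-turn : ∀ {p q} ws → new ∈ ws → Unique (p ∷ ws) → q ∉ ws →
            p ≢ q ⊎ 2 ≤ length ws → ¬ Linked Edge (p ∷ ws ++ [ q ])
  no-turn (_ ∷ []) (here refl) _ _ (inj₁ p≢q) (e ∷ e′ ∷ _) =
    p≢q (trans (new-inv refl e) (sym (new-inv refl (edge-sym e′))))
  no-turn (_ ∷ []) (here refl) _ _ (inj₂ (s≤s ())) _
  no-turn (_ ∷ y ∷ ws) (here refl) ((_ ∷ p≢y ∷ _) ∷ _) _ _ (e ∷ e′ ∷ _) =
    p≢y (trans (new-inv refl e) (sym (new-inv refl (edge-sym e′))))
  no-turn (z ∷ ws) (there new∈) (_ ∷ un) q∉ _ (_ ∷ l) =
    no-turn ws new∈ un (q∉ ∘ there) (inj₁ λ z≡q → q∉ (here (sym z≡q))) l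

  last-edge : ∀ {q} z zs → Linked Edge (z ∷ zs ++ [ q ]) →
              ∃ λ y → y ∈ z ∷ zs × Edge y q
  last-edge z []        (e ∷ _) = z , here refl , e
  last-edge z (z′ ∷ zs) (_ ∷ l) with y , y∈ , e ← last-edge z′ zs l = y , there y∈ , e

  G-acyclic : G.Acyclic
  G-acyclic {a} {ws} un 2≤ l with new Fin.≟ a
  G-acyclic {a} {z ∷ z′ ∷ ws} (_ ∷ z∉ ∷ _) 2≤ (e ∷ _ ∷ l) | yes refl
    with y , y∈ , e′ ← last-edge z′ ws l =
    All.lookup z∉ y∈ (trans (new-inv refl (edge-sym e)) (sym (new-inv refl e′)))
  G-acyclic {a} {_ ∷ []} un (s≤s ()) l | yes refl
  G-acyclic {a} {ws} un@(a∉ ∷ _) 2≤ l | no new≢a with Any.any? (new Fin.≟_) ws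
  ... | yes new∈ =
    no-turn ws new∈ un (λ a∈ → All.lookup a∉ a∈ refl) (inj₂ 2≤) l
  ... | no new∉
    with old-list (a ∷ ws) (λ { (here p) → new≢a p ; (there p) → new∉ p })
  ... | x ∷ xs , refl =
    acyclic (Unique.map⁻ un) (subst (2 ≤_) (length-map inject₁ xs) 2≤)
      (Linked.map (old-inv refl refl)
        (Linked.map⁻ (subst (Linked Edge ∘ (inject₁ x ∷_))
                       (sym (map-++ inject₁ xs [ x ])) l)))

  lift : ∀ d {x y} → Walk d x y → G.Walk d (inject₁ x) (inject₁ y)
  lift zero    eq          = cong inject₁ eq
  lift (suc d) (z , e , w) = inject₁ z , old e , lift d w

  -- Contract the new edge.
  project : ∀ {x} d {a b} → a ≡ inject₁ x ⊎ (a ≡ new × x ≡ v) →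
            ∀ {y} → b ≡ inject₁ y → G.Walk d a b → Connected x y
  project zero (inj₁ p) q refl = 0 , Fin.inject₁-injective (trans (sym p) q)
  project zero (inj₂ (p , _)) q refl = contradiction (trans (sym p) q) new≢old
  project (suc d) (inj₁ p) q (_ , old {x} {y} e , w)
    with refl ← Fin.inject₁-injective p
    with d′ , w′ ← project d (inj₁ refl) q w = suc d′ , y , e , w′
  project (suc d) (inj₁ p) q (_ , down , w)
    with refl ← Fin.inject₁-injective p = project d (inj₂ (refl , refl)) q w
  project (suc d) (inj₁ p) q (_ , up , w) = contradiction p new≢old
  project (suc d) (inj₂ (p , _)) q (_ , old e , w) = contradiction (sym p) new≢old
  project (suc d) (inj₂ (p , _)) q (_ , down , w) = contradiction (sym p) new≢old
  project (suc d) (inj₂ (p , refl)) q (_ , up , w) = project d (inj₁ refl) q w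

  G-rooted : ∀ a → ∃! _≡_ λ r → IsRoot r × G.Connected a r
  G-rooted a with view a
  ... | ‵inject₁ x with r , (rr , d , w) , uniq ← rooted x =
    inject₁ r , (old rr , d , lift d w) ,
    λ { (old rr′ , d , w) → cong inject₁ (uniq (rr′ , project d (inj₁ refl) refl w)) }
  ... | ‵fromℕ with r , (rr , d , w) , uniq ← rooted v =
    inject₁ r , (old rr , suc d , inject₁ v , up , lift d w) ,
    λ { (old rr′ , d , w) →
          cong inject₁ (uniq (rr′ , project d (inj₂ (refl , refl)) refl w)) }

  attach : RF (suc n)
  attach = record
    { graph = newGraph ; Root = IsRoot ; root? = isRoot?
    ; acyclic = G-acyclic ; rooted = G-rooted }

infix 30 _⁺
_⁺ : ∀ {n} → RF n → .{{NonZero n}} → RF (suc n)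
f ⁺ = Attach.attach f (lastVertex f)

------------------------------------------------------------------------
-- Equivalence of forests

infix 4 _∼_
record _∼_ {n} (f₁ f₂ : RF n) : Set where
  private
    module F₁ = RF f₁
    module F₂ = RF f₂
  field
    ψ      : Permutation′ n
    ψ-edge : ∀ u v → (u F₁.— v) ⇔ ((ψ ⟨$⟩ʳ u) F₂.— (ψ ⟨$⟩ʳ v))
    ψ-h    : ∀ v → F₂.h (ψ ⟨$⟩ʳ v) ≡ F₁.h v
    ψ-η    : ∀ v → F₂.η (ψ ⟨$⟩ʳ v) ≡ F₁.η v

Class : ∀ {n} → RF n → Pred (RF n) 0ℓ
Class f g = f ∼ g

------------------------------------------------------------------------
-- Parking functions

-- The coordinate a_{i+1} of an n-tuple a is a i, for i : Fin n.

Entry : ∀ {n} → ℕ → Pred (Vector ℕ n) 0ℓ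
Entry k a = ∃ λ i → a i ≡ k

PF : ∀ n → Pred (Vector ℕ n) 0ℓ
PF n a = (∀ i → 1 ≤ a i) ×
  ∃ λ (b : Vector ℕ n) → a ↭ b × (∀ {i j} → i Fin.≤ j → b i ≤ b j) × (∀ i → b i ≤ suc (toℕ i))

-- Meant for 1 < k ≤ n.
PFₖ : ∀ n → ℕ → Pred (Vector ℕ n) 0ℓ
PFₖ n k a = PF n a × ¬ Entry k a × (∀ j → k < j → j ≤ n → Entry j a)

IsPermutation : ∀ {n} → Pred (Vector ℕ n) 0ℓ
IsPermutation {n} a = a ↭ (λ (i : Fin n) → suc (toℕ i))

------------------------------------------------------------------------
-- The bijection φ

module _ {n} (f : RF n) where
  open RF f

  pick : {P : Pred (Fin n) 0ℓ} → U.Decidable P → Maybe (Fin n)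
  pick P? = Maybe.map proj₁ (dec⇒maybe (Fin.any? P?))

  -- Each of the following three picks the only vertex with its property.

  binaryRoot : Maybe (Fin n)
  binaryRoot = pick λ r → root? r ×-dec (η r ≟ 1)

  leftChild : Fin n → Maybe (Fin n)
  leftChild v = pick λ w → sibling? v w ×-dec (η w ≟ suc (η v))

  rightChild : Fin n → Maybe (Fin n)
  rightChild v = pick λ x → parent? v x ×-dec (η x ≟ 1)

  -- The part of depth at most m of the binary tree below a vertex.  A
  -- branch has distinct vertices, so depth n gives the whole tree.
  binarySubtree : ℕ → Maybe (Fin n) → Tree (Fin n) ⊤
  binarySubtree _       nothing  = leaf tt
  binarySubtree zero    (just _) = leaf tt
  binarySubtree (suc m) (just v) =
    node (binarySubtree m (leftChild v)) v (binarySubtree m (rightChild v))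

  binaryTree : Tree (Fin n) ⊤
  binaryTree = binarySubtree n binaryRoot

data Step (n : ℕ) : Set where
  up    : Fin n → Step n
  right : Step n

dyck : ∀ {n} → Tree (Fin n) ⊤ → List (Step n)
dyck (leaf _)     = []
dyck (node l v r) = up v ∷ dyck l ++ right ∷ dyck r

-- Number of right steps preceding the up step labeled i.
rightsBefore : ∀ {n} → Fin n → List (Step n) → ℕ
rightsBefore i []          = 0
rightsBefore i (right ∷ s) = suc (rightsBefore i s)
rightsBefore i (up j ∷ s)  with i Fin.≟ j
... | yes _ = 0
... | no _  = rightsBefore i s

φ : ∀ {n} → RF n → Vector ℕ n
φ f i = suc (rightsBefore i (dyck (binaryTree f)))

-- RFₖ n k is meant for 1 ≤ k ≤ n.
RFₖ : ∀ n → ℕ → Pred (RF n) 0ℓ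
RFₖ n 1 f = IsPermutation (φ f)
RFₖ n k f = PFₖ n k (φ f)

{-# OPTIONS --safe #-}
module Submission where

-- In the word of f the end of P_f is visited last, so attaching a new leaf labeled n+1 to
-- v_f appends an up step and a right step, and φ(f⁺) = (φ(f), n+1).  For k ≤ n, appending
-- the entry n+1 preserves and reflects membership in PF_{·,k}, as well as being a
-- permutation.  Conversely, if φ(g) has the entry n+1, then only one right step follows the
-- corresponding up step, which forces that vertex to be v_g and to have a parent but no
-- siblings; deleting it, and relabeling the others in order, gives f with f⁺ ∼ g.

open import Defs
open import Data.Empty using (⊥)
open import Data.Fin as Fin using (Fin; zero; suc; toℕ; fromℕ; inject₁; punchIn)
open import Data.Fin.Permutation as Perm
  using (Permutation′; _⟨$⟩ʳ_; _⟨$⟩ˡ_; inverseˡ; inverseʳ; transpose; _∘ₚ_; flip; remove; insert;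
         punchIn-permute; insert-punchIn; permutation)
import Data.Fin.Properties as Fin
open import Data.Fin.Relation.Unary.Top using (view; view-inject₁; view-fromℕ; ‵fromℕ; ‵inject₁)
open import Data.List as List using (List; []; _∷_; _++_; length; allFin)
open import Data.List.Membership.Propositional using (_∈_; _∉_)
open import Data.List.Membership.Propositional.Properties
  using (∈-filter⁺; ∈-filter⁻; ∈-allFin; ∈-∃++; ∈-++⁺ˡ; ∈-++⁺ʳ; ∈-++⁻; ∈-map⁺; ∈-map⁻)
open import Data.List.Properties
  using (length-++-sucʳ; length-tabulate; map-++; ++-assoc; length-++; ++-identityʳ; length-map)
open import Data.List.Relation.Binary.Subset.Propositional using () renaming (_⊆_ to _⊆ₗ_)
open import Data.List.Relation.Unary.All as All using (All; []; _∷_)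
import Data.List.Relation.Unary.All.Properties as All
open import Data.List.Relation.Unary.AllPairs using ([]; _∷_)
open import Data.List.Relation.Unary.Any as Any using (here; there)
open import Data.List.Relation.Unary.Linked using (Linked; []; [-]; _∷_)
import Data.List.Relation.Unary.Linked.Properties as Linked
open import Data.List.Relation.Unary.Unique.Propositional using (Unique)
import Data.List.Relation.Unary.Unique.Propositional.Properties as Unique
open import Data.Maybe as Maybe using (Maybe; just; nothing)
open import Data.Nat
  using (ℕ; zero; suc; _+_; _*_; _≤_; _<_; z≤n; s≤s; s≤s⁻¹; NonZero; >-nonZero; >-nonZero⁻¹)
open import Data.Nat.Properties as ℕ using (≤-trans; _≟_)
open import Data.Product using (∃; ∃!; _×_; _,_; proj₁; proj₂)
open import Data.Sum as Sum using (_⊎_; inj₁; inj₂; [_,_]′)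
open import Data.Tree.Binary using (Tree; leaf; node; mapₙ)
open import Data.Unit using (⊤; tt)
open import Data.Vec.Functional using (Vector)
open import Data.Vec.Functional.Relation.Binary.Permutation using (_↭_)
open import Function using (_∘_; _⇔_; mk⇔; Equivalence)
open import Level using (0ℓ)
open import Relation.Binary using (tri<; tri≈; tri>)
open import Relation.Binary.Construct.Closure.ReflexiveTransitive using (Star; ε; _◅_; _◅◅_)
open import Relation.Binary.PropositionalEquality
open import Relation.Nullary using (¬_; yes; no; contradiction)
open import Relation.Nullary.Decidable using (_×-dec_)
import Relation.Unary as U
open U using (Pred; _⊆_; _≐_)

-- Finite sets

-- The depth bound in `binaryTree` is n for `f` and n+1 for `f ⁺`, so the two trees cannot be
-- compared by recursion on it. They are compared through the relation `Unfolds`, which describes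
-- the tree without a bound and determines it. That no label repeats follows from two facts: a
-- vertex has at most one parent in the binary tree, and a key grows on the way down.
--
-- The leaf deleted from `g` may carry any label, not just n+1. Both directions therefore share one
-- notion, `Extension f g`: an order-preserving copy of `f` with a leaf of arbitrary label attached
-- at the end of the first path. An only child has η = 1 whatever its label, so any two extensions
-- of one `f` are equivalent. The copy is made by `inject₁` for `f ⁺` and by `punchIn` for a
-- deletion.
--
-- The two bounds on k have separate tasks: k ≤ n puts n+1 among the entries that must occur, and 1
-- ≤ k ≤ n gives n+1 ≥ 2, so that the vertex visited last is not the root of the binary tree and has
-- a parent.

unique-⊆⇒length≤ : ∀ {A : Set} {xs ys : List A} →
                   Unique xs → xs ⊆ₗ ys → length xs ≤ length ys
unique-⊆⇒length≤ []        _   = z≤n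
unique-⊆⇒length≤ {xs = x ∷ xs} (x∉ ∷ un) sub with ∈-∃++ (sub (here refl))
... | as , bs , refl = subst (suc (length xs) ≤_) (sym (length-++-sucʳ as x bs))
                         (s≤s (unique-⊆⇒length≤ un rest))
  where
  rest : xs ⊆ₗ as ++ bs
  rest z∈ with ∈-++⁻ as (sub (there z∈))
  ... | inj₁ z∈as         = ∈-++⁺ˡ z∈as
  ... | inj₂ (here refl)  = contradiction refl (All.lookup x∉ z∈)
  ... | inj₂ (there z∈bs) = ∈-++⁺ʳ as z∈bs

unique⇒length≤ : ∀ {n} {xs : List (Fin n)} → Unique xs → length xs ≤ n
unique⇒length≤ {n} {xs} un = subst (length xs ≤_) (length-tabulate (λ i → i))
  (unique-⊆⇒length≤ un λ _ → ∈-allFin _)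

maximalFin : ∀ {n} {P : Pred (Fin n) 0ℓ} → U.Decidable P → ∃ P →
             ∃ λ i → P i × (∀ {j} → P j → j Fin.≤ i)
maximalFin {suc n} P? (i , pi) with Fin.any? (P? ∘ suc)
... | yes later with k , pk , greatest ← maximalFin (P? ∘ suc) later =
  suc k , pk , λ { {zero} _ → z≤n ; {suc j} pj → s≤s (greatest pj) }
maximalFin {suc n} P? (zero , pi) | no ¬later =
  zero , pi , λ { {zero} _ → z≤n ; {suc j} pj → contradiction (j , pj) ¬later }
maximalFin {suc n} P? (suc i , pi) | no ¬later = contradiction (i , pi) ¬later

unique-++⇒disjoint : ∀ {A : Set} {x : A} xs {ys} → Unique (xs ++ ys) → x ∈ xs → x ∉ ys
unique-++⇒disjoint (x ∷ xs) (x∉ ∷ _) (here refl) x∈ys = All.lookup (All.++⁻ʳ xs x∉) x∈ys refl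
unique-++⇒disjoint (x ∷ xs) (_ ∷ un) (there x∈) x∈ys = unique-++⇒disjoint xs un x∈ x∈ys

unique-++ˡ : ∀ {A : Set} (xs : List A) {ys} → Unique (xs ++ ys) → Unique ys
unique-++ˡ []       un       = un
unique-++ˡ (x ∷ xs) (_ ∷ un) = unique-++ˡ xs un

-- Dyck words of binary trees

labels : ∀ {A : Set} → Tree A ⊤ → List A
labels (leaf _)     = []
labels (node l v r) = v ∷ labels l ++ labels r

labels-map : ∀ {A B : Set} (ι : A → B) t → labels (mapₙ ι t) ≡ List.map ι (labels t)
labels-map ι (leaf _)     = refl
labels-map ι (node l v r) = cong (ι v ∷_) (trans
  (cong₂ _++_ (labels-map ι l) (labels-map ι r)) (sym (map-++ ι (labels l) (labels r))))

-- The rightmost branch is the one the walk visits last.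
graft : ∀ {A : Set} → Tree A ⊤ → A → Tree A ⊤
graft (leaf _)     w = node (leaf tt) w (leaf tt)
graft (node l v r) w = node l v (graft r w)

-- The shape in which a single right step follows `up w`: a left subtree of `w` would add right
-- steps between `up w` and the right step of `w` itself.
data EndsIn {A : Set} (w : A) : Tree A ⊤ → Set where
  stop : EndsIn w (node (leaf tt) w (leaf tt))
  turn : ∀ {l v r} → EndsIn w r → EndsIn w (node l v r)

-- The right step of a node precedes the word of its right subtree, so whatever hangs at the end of
-- the rightmost branch is read at the very end.
dyck-graft : ∀ {n} t (w : Fin n) → dyck (graft t w) ≡ dyck t ++ up w ∷ right ∷ []
dyck-graft (leaf _)     w = refl
dyck-graft (node l v r) w = cong (up v ∷_) (trans
  (cong (λ s → dyck l ++ right ∷ s) (dyck-graft r w))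
  (sym (++-assoc (dyck l) (right ∷ dyck r) _)))

module _ {n} (i : Fin n) where

  rightsBefore-here : ∀ s → rightsBefore i (up i ∷ s) ≡ 0
  rightsBefore-here s with i Fin.≟ i
  ... | yes _ = refl
  ... | no ≢  = contradiction refl ≢

  rightsBefore-there : ∀ {v} s → i ≢ v → rightsBefore i (up v ∷ s) ≡ rightsBefore i s
  rightsBefore-there {v} s i≢v with i Fin.≟ v
  ... | yes i≡v = contradiction i≡v i≢v
  ... | no _    = refl

  -- A tree has one right step per label, and without `up i` the count runs through all of them. The
  -- continuation `s` is present because a left subtree is read with more of the word behind it.
  rightsBefore-∉ : ∀ t s → i ∉ labels t →
                   rightsBefore i (dyck t ++ s) ≡ length (labels t) + rightsBefore i s
  rightsBefore-∉ (leaf _)     s _  = refl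
  rightsBefore-∉ (node l v r) s i∉ = begin
    rightsBefore i (up v ∷ (dyck l ++ right ∷ dyck r) ++ s)
      ≡⟨ rightsBefore-there _ (i∉ ∘ here) ⟩
    rightsBefore i ((dyck l ++ right ∷ dyck r) ++ s)
      ≡⟨ cong (rightsBefore i) (++-assoc (dyck l) (right ∷ dyck r) s) ⟩
    rightsBefore i (dyck l ++ right ∷ (dyck r ++ s))
      ≡⟨ rightsBefore-∉ l _ (i∉ ∘ there ∘ ∈-++⁺ˡ) ⟩
    length (labels l) + suc (rightsBefore i (dyck r ++ s))
      ≡⟨ cong (λ m → length (labels l) + suc m)
           (rightsBefore-∉ r s (i∉ ∘ there ∘ ∈-++⁺ʳ (labels l))) ⟩
    length (labels l) + suc (length (labels r) + rightsBefore i s)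
      ≡⟨ ℕ.+-suc (length (labels l)) _ ⟩
    suc (length (labels l) + (length (labels r) + rightsBefore i s))
      ≡⟨ cong suc (ℕ.+-assoc (length (labels l)) _ _) ⟨
    suc (length (labels l) + length (labels r) + rightsBefore i s)
      ≡⟨ cong (λ m → suc (m + rightsBefore i s)) (length-++ (labels l)) ⟨
    length (labels (node l v r)) + rightsBefore i s ∎
    where open ≡-Reasoning

  -- The count stops at `up i`, inside the word of the tree, hence does not depend on `s`. The bound
  -- is strict because the right step of `i` comes after `up i`.
  rightsBefore-∈ : ∀ t → i ∈ labels t →
    ∃ λ m → m < length (labels t) × (∀ s → rightsBefore i (dyck t ++ s) ≡ m)
  rightsBefore-∈ (node l v r) i∈ with i Fin.≟ v
  ... | yes refl = 0 , s≤s z≤n , λ s → refl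
  rightsBefore-∈ (node l v r) (here i≡v) | no i≢v = contradiction i≡v i≢v
  rightsBefore-∈ (node l v r) (there i∈) | no i≢v with Any.any? (i Fin.≟_) (labels l)
  ... | yes i∈l with m , m< , eq ← rightsBefore-∈ l i∈l =
    m ,
    ≤-trans m< (≤-trans (ℕ.m≤m+n _ _)
      (≤-trans (ℕ.≤-reflexive (sym (length-++ (labels l)))) (ℕ.n≤1+n _))) ,
    λ s → trans (cong (rightsBefore i) (++-assoc (dyck l) (right ∷ dyck r) s)) (eq _)
  ... | no i∉l with ∈-++⁻ (labels l) i∈
  ...   | inj₁ i∈l = contradiction i∈l i∉l
  ...   | inj₂ i∈r with m , m< , eq ← rightsBefore-∈ r i∈r =
    length (labels l) + suc m ,
    subst (length (labels l) + suc m <_)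
      (trans (ℕ.+-suc (length (labels l)) _) (cong suc (sym (length-++ (labels l)))))
      (ℕ.+-monoʳ-< (length (labels l)) (s≤s m<)) ,
    λ s → trans (cong (rightsBefore i) (++-assoc (dyck l) (right ∷ dyck r) s))
      (trans (rightsBefore-∉ l _ i∉l) (cong (λ m → length (labels l) + suc m) (eq s)))

  rightsBefore-< : ∀ t → i ∈ labels t → rightsBefore i (dyck t) < length (labels t)
  rightsBefore-< t i∈ with m , m< , eq ← rightsBefore-∈ t i∈ =
    subst (_< length (labels t))
      (trans (sym (eq [])) (cong (rightsBefore i) (++-identityʳ (dyck t)))) m<

  rightsBefore-++ : ∀ t s → i ∈ labels t → rightsBefore i (dyck t ++ s) ≡ rightsBefore i (dyck t)
  rightsBefore-++ t s i∈ with m , _ , eq ← rightsBefore-∈ t i∈ =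
    trans (eq s) (trans (sym (eq [])) (cong (rightsBefore i) (++-identityʳ (dyck t))))

  -- At the root the count is 0, which leaves room for one label only. Inside the left subtree, the
  -- right step of the root would follow `up i` in addition to that of `i`. Inside the right
  -- subtree, all that precedes it cancels.
  rightsBefore-maximal : ∀ t → i ∈ labels t → suc (rightsBefore i (dyck t)) ≡ length (labels t) →
                         EndsIn i t
  rightsBefore-maximal (node l v r) i∈ eq with i Fin.≟ v
  rightsBefore-maximal (node (leaf _) v (leaf _)) i∈ eq | yes refl = stop
  rightsBefore-maximal (node (leaf _) v (node _ _ _)) i∈ () | yes refl
  rightsBefore-maximal (node (node _ _ _) v r) i∈ () | yes refl
  rightsBefore-maximal (node l v r) (here i≡v) eq | no i≢v = contradiction i≡v i≢v
  rightsBefore-maximal (node l v r) (there i∈) eq | no i≢v with Any.any? (i Fin.≟_) (labels l)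
  ... | yes i∈l = contradiction
    (trans (sym (rightsBefore-++ l _ i∈l)) (ℕ.suc-injective eq))
    (ℕ.<⇒≢ (≤-trans (rightsBefore-< l i∈l)
      (≤-trans (ℕ.m≤m+n _ _) (ℕ.≤-reflexive (sym (length-++ (labels l)))))))
  ... | no i∉l with ∈-++⁻ (labels l) i∈
  ...   | inj₁ i∈l = contradiction i∈l i∉l
  ...   | inj₂ i∈r = turn (rightsBefore-maximal r i∈r (ℕ.+-cancelˡ-≡ (length (labels l)) _ _
    (trans (sym (rightsBefore-∉ l _ i∉l)) (trans (ℕ.suc-injective eq) (length-++ (labels l))))))

mapStep : ∀ {m n} → (Fin m → Fin n) → Step m → Step n
mapStep ι (up i) = up (ι i)
mapStep ι right  = right

module _ {m n} (ι : Fin m → Fin n) where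

  dyck-map : ∀ t → dyck (mapₙ ι t) ≡ List.map (mapStep ι) (dyck t)
  dyck-map (leaf _)     = refl
  dyck-map (node l v r) = cong (up (ι v) ∷_) (trans
    (cong₂ (λ s s′ → s ++ right ∷ s′) (dyck-map l) (dyck-map r))
    (sym (map-++ (mapStep ι) (dyck l) (right ∷ dyck r))))

  rightsBefore-map : (∀ {x y} → ι x ≡ ι y → x ≡ y) → ∀ i s →
                     rightsBefore (ι i) (List.map (mapStep ι) s) ≡ rightsBefore i s
  rightsBefore-map inj i []          = refl
  rightsBefore-map inj i (right ∷ s) = cong suc (rightsBefore-map inj i s)
  rightsBefore-map inj i (up j ∷ s) with i Fin.≟ j | ι i Fin.≟ ι j
  ... | yes _   | yes _  = refl
  ... | yes i≡j | no ≢   = contradiction (cong ι i≡j) ≢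
  ... | no i≢j  | yes eq = contradiction (inj eq) i≢j
  ... | no _    | no _   = rightsBefore-map inj i s

-- Trees generated by partial child functions

module Unfolding {V : Set} (left right : V → Maybe V) where

  -- The tree of `binarySubtree` freed from its depth bound; `unfolds-functional` shows that there
  -- is at most one.
  data Unfolds : Maybe V → Tree V ⊤ → Set where
    empty  : Unfolds nothing (leaf tt)
    branch : ∀ {v l r} → Unfolds (left v) l → Unfolds (right v) r →
             Unfolds (just v) (node l v r)

  data Below (y u : V) : Set where
    onLeft  : left u ≡ just y → Below y u
    onRight : right u ≡ just y → Below y u

  Ascends : V → V → Set
  Ascends = Star Below

  unfolds-ascends : ∀ {mx t y} → Unfolds mx t → y ∈ labels t →
                    ∃ λ a → mx ≡ just a × Ascends y a
  unfolds-ascends (branch _ _) (here refl) = _ , refl , ε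
  unfolds-ascends (branch {l = l} ul ur) (there y∈) with ∈-++⁻ (labels l) y∈
  ... | inj₁ y∈l with a , eq , s ← unfolds-ascends ul y∈l = _ , refl , s ◅◅ onLeft eq ◅ ε
  ... | inj₂ y∈r with a , eq , s ← unfolds-ascends ur y∈r = _ , refl , s ◅◅ onRight eq ◅ ε

  root∈labels : ∀ {v mx t} → mx ≡ just v → Unfolds mx t → v ∈ labels t
  root∈labels refl (branch _ _) = here refl

  below∈labels : ∀ {y u mx t} → Below y u → Unfolds mx t → u ∈ labels t → y ∈ labels t
  below∈labels (onLeft p) (branch ul ur) (here refl) = there (∈-++⁺ˡ (root∈labels p ul))
  below∈labels (onRight p) (branch {l = l} ul ur) (here refl) =
    there (∈-++⁺ʳ (labels l) (root∈labels p ur))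
  below∈labels b (branch {l = l} ul ur) (there u∈) with ∈-++⁻ (labels l) u∈
  ... | inj₁ u∈l = there (∈-++⁺ˡ (below∈labels b ul u∈l))
  ... | inj₂ u∈r = there (∈-++⁺ʳ (labels l) (below∈labels b ur u∈r))

  module _ (key : V → ℕ) (below-key : ∀ {y u} → Below y u → key u < key y)
           (below-unique : ∀ {y u v} → Below y u → Below y v → u ≡ v)
           (left≢right : ∀ {u a b} → left u ≡ just a → right u ≡ just b → a ≢ b) where

    ascends-key : ∀ {y a} → Ascends y a → key a ≤ key y
    ascends-key ε       = ℕ.≤-refl
    ascends-key (b ◅ s) = ≤-trans (ascends-key s) (ℕ.<⇒≤ (below-key b))

    -- Unique parents make the ancestors of `y` a chain.
    ascends-comparable : ∀ {y a b} → Ascends y a → Ascends y b → Ascends a b ⊎ Ascends b a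
    ascends-comparable ε       t       = inj₁ t
    ascends-comparable (p ◅ s) ε       = inj₂ (p ◅ s)
    ascends-comparable (p ◅ s) (q ◅ t) with refl ← below-unique p q = ascends-comparable s t

    -- Otherwise one of `a`, `b` lies below the other. Its first step upward reaches the common
    -- parent `v`, so the other one is reached from `v` and has a key at most that of `v`, its own
    -- parent.
    ascends-left-right : ∀ {y v a b} → left v ≡ just a → right v ≡ just b →
                         Ascends y a → ¬ Ascends y b
    ascends-left-right {v = v} la rb ya yb =
      [ passes (onLeft la) (onRight rb) (left≢right la rb)
      , passes (onRight rb) (onLeft la) (left≢right la rb ∘ sym)
      ]′ (ascends-comparable ya yb)
      where
      passes : ∀ {c d} → Below c v → Below d v → c ≢ d → ¬ Ascends c d
      passes bc bd c≢d ε = c≢d refl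
      passes bc bd c≢d (p ◅ s) with refl ← below-unique bc p =
        ℕ.<⇒≱ (below-key bd) (ascends-key s)

    -- A label in both subtrees would have both children of `v` as ancestors, and `v` inside one of
    -- its own subtrees would contradict the growth of keys.
    unfolds-unique : ∀ {mx t} → Unfolds mx t → Unique (labels t)
    unfolds-unique empty = []
    unfolds-unique (branch {v} {l} {r} ul ur) =
      All.++⁺ (All.tabulate λ y∈ → v≢ onLeft (unfolds-ascends ul y∈))
              (All.tabulate λ y∈ → v≢ onRight (unfolds-ascends ur y∈))
      ∷ Unique.++⁺ (unfolds-unique ul) (unfolds-unique ur)
          λ (y∈l , y∈r) → disjoint (unfolds-ascends ul y∈l) (unfolds-ascends ur y∈r)
      where
      v≢ : ∀ {mx y} → (∀ {a} → mx ≡ just a → Below a v) →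
           (∃ λ a → mx ≡ just a × Ascends y a) → v ≢ y
      v≢ below (a , eq , s) refl = ℕ.<⇒≱ (below-key (below eq)) (ascends-key s)
      disjoint : ∀ {y} → (∃ λ a → left v ≡ just a × Ascends y a) →
                 ¬ (∃ λ b → right v ≡ just b × Ascends y b)
      disjoint (a , la , ya) (b , rb , yb) = ascends-left-right la rb ya yb

module _ {V : Set} {left right : V → Maybe V} where
  open Unfolding left right

  unfolds-leaf : ∀ {mx t} → Unfolds mx (leaf t) → mx ≡ nothing
  unfolds-leaf empty = refl

  unfolds-node : ∀ {mx l v r} → Unfolds mx (node l v r) → mx ≡ just v
  unfolds-node (branch _ _) = refl

  unfolds-functional : ∀ {mx t t′} → Unfolds mx t → Unfolds mx t′ → t ≡ t′
  unfolds-functional empty          empty            = refl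
  unfolds-functional (branch ul ur) (branch ul′ ur′) =
    cong₂ (λ l r → node l _ r) (unfolds-functional ul ul′) (unfolds-functional ur ur′)

-- Siblings

module _ {n} (f : RF n) where
  open RF f

  h≡0⇒Root : ∀ {v} → h v ≡ 0 → Root v
  h≡0⇒Root {v} hv = subst Root (sym (h≡0⇒root f hv)) (rootOf-root f v)

  -- `Sibling` without the inequality, which makes it transitive.
  Kin : Fin n → Fin n → Set
  Kin u w = (∃ λ p → Parent p u × Parent p w) ⊎ (Root u × Root w)

  kin-sym : ∀ {u w} → Kin u w → Kin w u
  kin-sym (inj₁ (p , pu , pw)) = inj₁ (p , pw , pu)
  kin-sym (inj₂ (ru , rw))     = inj₂ (rw , ru)

  kin-trans : ∀ {u v w} → Kin u v → Kin v w → Kin u w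
  kin-trans (inj₁ (p , pu , pv)) (inj₁ (q , qv , qw))
    with refl ← parent-unique f pv qv = inj₁ (p , pu , qw)
  kin-trans (inj₁ (p , pu , pv)) (inj₂ (rv , _)) = contradiction pv (root-no-parent f rv)
  kin-trans (inj₂ (_ , rv)) (inj₁ (q , qv , _))  = contradiction qv (root-no-parent f rv)
  kin-trans (inj₂ (ru , _)) (inj₂ (_ , rw))      = inj₂ (ru , rw)

  kin-h : ∀ {u w} → Kin u w → h u ≡ h w
  kin-h (inj₁ (p , (_ , hu) , (_ , hw))) = trans hu (sym hw)
  kin-h (inj₂ (ru , rw))                 = trans (h-root f ru) (sym (h-root f rw))

  ∈-smallerSiblings⁺ : ∀ {v w} → Sibling v w → w Fin.< v → w ∈ smallerSiblings v
  ∈-smallerSiblings⁺ s w<v = ∈-filter⁺ _ (∈-allFin _) (s , w<v)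

  ∈-smallerSiblings⁻ : ∀ {v w} → w ∈ smallerSiblings v → Sibling v w × w Fin.< v
  ∈-smallerSiblings⁻ {v} w∈ =
    proj₂ (∈-filter⁻ (λ w → sibling? v w ×-dec (w Fin.<? v)) {xs = allFin n} w∈)

  smallerSiblings-unique : ∀ v → Unique (smallerSiblings v)
  smallerSiblings-unique v = Unique.filter⁺ _ (Unique.allFin⁺ n)

  -- The smaller siblings of `u`, together with `u` itself, are distinct smaller siblings of `v`.
  η-mono-< : ∀ {u v} → Kin u v → u Fin.< v → η u < η v
  η-mono-< {u} {v} uv u<v = s≤s (unique-⊆⇒length≤
    (All.tabulate (λ x∈ u≡x → Fin.<⇒≢ (proj₂ (∈-smallerSiblings⁻ x∈)) (sym u≡x))
      ∷ smallerSiblings-unique u) sub)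
    where
    sub : u ∷ smallerSiblings u ⊆ₗ smallerSiblings v
    sub (here refl) = ∈-smallerSiblings⁺ (Fin.<⇒≢ u<v ∘ sym , kin-sym uv) u<v
    sub (there x∈) with (_ , ux) , x<u ← ∈-smallerSiblings⁻ x∈ =
      ∈-smallerSiblings⁺ (Fin.<⇒≢ x<v ∘ sym , kin-trans (kin-sym uv) ux) x<v
      where x<v = ℕ.<-trans x<u u<v

  η-injective : ∀ {u v} → Kin u v → η u ≡ η v → u ≡ v
  η-injective {u} {v} uv eq with Fin.<-cmp u v
  ... | tri≈ _ u≡v _ = u≡v
  ... | tri< u<v _ _ = contradiction eq (ℕ.<⇒≢ (η-mono-< uv u<v))
  ... | tri> _ _ v<u = contradiction (sym eq) (ℕ.<⇒≢ (η-mono-< (kin-sym uv) v<u))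

  η≤n : ∀ v → η v ≤ n
  η≤n v = unique⇒length≤
    (All.tabulate (λ x∈ v≡x → Fin.<⇒≢ (proj₂ (∈-smallerSiblings⁻ x∈)) (sym v≡x))
      ∷ smallerSiblings-unique v)

  -- The witness is the greatest smaller sibling of `v`: all the others are then smaller siblings of
  -- it, so the two values of `η` differ by exactly one.
  previousSibling : ∀ {v e} → η v ≡ suc (suc e) → ∃ λ u → Sibling u v × η v ≡ suc (η u)
  previousSibling {v} eq = go (some (smallerSiblings v) (ℕ.suc-injective eq) λ x∈ → x∈)
    where
    Smaller : Pred (Fin n) 0ℓ
    Smaller x = Sibling v x × x Fin.< v
    some : ∀ xs {e} → length xs ≡ suc e → xs ⊆ₗ smallerSiblings v → ∃ Smaller
    some (x ∷ xs) _ sub = x , ∈-smallerSiblings⁻ (sub (here refl))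
    go : ∃ Smaller → ∃ λ u → Sibling u v × η v ≡ suc (η u)
    go ex with u , (vu , u<v) , greatest
                 ← maximalFin (λ x → sibling? v x ×-dec (x Fin.<? v)) ex =
      u , sibling-sym f vu , ℕ.≤-antisym
        (s≤s (unique-⊆⇒length≤ (smallerSiblings-unique v) sub))
        (η-mono-< (kin-sym (proj₂ vu)) u<v)
      where
      sub : smallerSiblings v ⊆ₗ u ∷ smallerSiblings u
      sub {x} x∈ with ∈-smallerSiblings⁻ x∈ | u Fin.≟ x
      ... | _             | yes refl = here refl
      ... | s@(vx , x<v) | no u≢x =
        there (∈-smallerSiblings⁺ (u≢x , kin-trans (kin-sym (proj₂ vu)) (proj₂ vx))
                (Fin.≤∧≢⇒< (greatest s) (u≢x ∘ sym)))

-- The binary tree of a forest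

module _ {n} (f : RF n) {P : Pred (Fin n) 0ℓ} (P? : U.Decidable P) where

  pick-just⁻ : ∀ {x} → pick f P? ≡ just x → P x
  pick-just⁻ eq with Fin.any? P?
  pick-just⁻ refl | yes (x , px) = px

  pick-nothing⁻ : pick f P? ≡ nothing → ∀ {x} → ¬ P x
  pick-nothing⁻ eq px with Fin.any? P?
  pick-nothing⁻ eq px | no ¬p = ¬p (_ , px)

  pick-just⁺ : (∀ {x y} → P x → P y → x ≡ y) → ∀ {x} → P x → pick f P? ≡ just x
  pick-just⁺ unique px with Fin.any? P?
  ... | yes (y , py) = cong just (unique py px)
  ... | no ¬p        = contradiction (_ , px) ¬p

  pick-nothing⁺ : (∀ {x} → ¬ P x) → pick f P? ≡ nothing
  pick-nothing⁺ ¬p with Fin.any? P?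
  ... | yes (y , py) = contradiction py ¬p
  ... | no _         = refl

-- `pick` returns whichever witness the search finds, so uniqueness of the target witness carries
-- the equation. Backwards, bare existence of a source witness suffices, since it only has to make
-- the two `nothing` cases agree.
pick-map : ∀ {m n} (f : RF m) (g : RF n) {P : Pred (Fin m) 0ℓ} {Q : Pred (Fin n) 0ℓ}
           (P? : U.Decidable P) (Q? : U.Decidable Q) (ι : Fin m → Fin n) →
           (∀ {x y} → Q x → Q y → x ≡ y) →
           (∀ {x} → P x → Q (ι x)) → (∀ {y} → Q y → ∃ λ x → P x) →
           pick g Q? ≡ Maybe.map ι (pick f P?)
pick-map f g P? Q? ι unique to from with Fin.any? P?
... | yes (x , px) = pick-just⁺ g Q? unique (to px)
... | no ¬p        = pick-nothing⁺ g Q? λ qy → ¬p (from qy)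

module _ {n} (f : RF n) where
  open RF f

  BinaryRoot : Fin n → Set
  BinaryRoot r = Root r × η r ≡ 1

  LeftChild : Fin n → Fin n → Set
  LeftChild v w = Sibling v w × η w ≡ suc (η v)

  RightChild : Fin n → Fin n → Set
  RightChild v w = Parent v w × η w ≡ 1

  binaryRoot? : U.Decidable BinaryRoot
  binaryRoot? r = root? r ×-dec (η r ≟ 1)

  leftChild? : ∀ v → U.Decidable (LeftChild v)
  leftChild? v w = sibling? v w ×-dec (η w ≟ suc (η v))

  rightChild? : ∀ v → U.Decidable (RightChild v)
  rightChild? v w = parent? v w ×-dec (η w ≟ 1)

  binaryRoot-unique : ∀ {x y} → BinaryRoot x → BinaryRoot y → x ≡ y
  binaryRoot-unique (rx , ex) (ry , ey) = η≡1-unique f ex ey (inj₂ (rx , ry))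

  leftChild-unique : ∀ {v x y} → LeftChild v x → LeftChild v y → x ≡ y
  leftChild-unique ((_ , vx) , ex) ((_ , vy) , ey) =
    η-injective f (kin-trans f (kin-sym f vx) vy) (trans ex (sym ey))

  rightChild-unique : ∀ {v x y} → RightChild v x → RightChild v y → x ≡ y
  rightChild-unique (vx , ex) (vy , ey) = η≡1-unique f ex ey (inj₁ (_ , vx , vy))

  binaryRoot⁺ : ∀ {r} → Root r → η r ≡ 1 → binaryRoot f ≡ just r
  binaryRoot⁺ rr er = pick-just⁺ f binaryRoot? binaryRoot-unique (rr , er)

  binaryRoot⁻ : ∀ {r} → binaryRoot f ≡ just r → BinaryRoot r
  binaryRoot⁻ = pick-just⁻ f binaryRoot?

  leftChild⁺ : ∀ {v w} → Sibling v w → η w ≡ suc (η v) → leftChild f v ≡ just w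
  leftChild⁺ vw ew = pick-just⁺ f (leftChild? _) leftChild-unique (vw , ew)

  leftChild⁻ : ∀ {v w} → leftChild f v ≡ just w → LeftChild v w
  leftChild⁻ = pick-just⁻ f (leftChild? _)

  rightChild⁺ : ∀ {v w} → Parent v w → η w ≡ 1 → rightChild f v ≡ just w
  rightChild⁺ vw ew = pick-just⁺ f (rightChild? _) rightChild-unique (vw , ew)

  rightChild⁻ : ∀ {v w} → rightChild f v ≡ just w → RightChild v w
  rightChild⁻ = pick-just⁻ f (rightChild? _)

  rightChild-nothing⁻ : ∀ {v} → rightChild f v ≡ nothing → Leaf v
  rightChild-nothing⁻ {v} eq w vw = let x , vx , ex = firstChild f vw in
    pick-nothing⁻ f (rightChild? v) eq (vx , ex)

  leftChild-nothing⁺ : ∀ {v} → (∀ {w} → ¬ Sibling v w) → leftChild f v ≡ nothing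
  leftChild-nothing⁺ {v} ¬s = pick-nothing⁺ f (leftChild? v) (¬s ∘ proj₁)

  rightChild-nothing⁺ : ∀ {v} → Leaf v → rightChild f v ≡ nothing
  rightChild-nothing⁺ {v} leaf-v = pick-nothing⁺ f (rightChild? v) (leaf-v _ ∘ proj₁)

  open Unfolding (leftChild f) (rightChild f)

  -- A left child has η at least 2 and a right child η equal to 1, so `y` cannot be both. In the
  -- first case its parent in the binary tree is the sibling with the preceding η, in the second its
  -- parent in the forest.
  below-unique : ∀ {y u v} → Below y u → Below y v → u ≡ v
  below-unique (onLeft p) (onLeft q) = unique (leftChild⁻ p) (leftChild⁻ q)
    where
    unique : ∀ {y u v} → LeftChild u y → LeftChild v y → u ≡ v
    unique ((_ , uy) , eu) ((_ , vy) , ev) =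
      η-injective f (kin-trans f uy (kin-sym f vy)) (ℕ.suc-injective (trans (sym eu) ev))
  below-unique (onLeft p) (onRight q) = contradiction
    (ℕ.suc-injective (trans (sym (proj₂ (leftChild⁻ p))) (proj₂ (rightChild⁻ q)))) ℕ.1+n≢0
  below-unique (onRight p) (onLeft q) = contradiction
    (ℕ.suc-injective (trans (sym (proj₂ (leftChild⁻ q))) (proj₂ (rightChild⁻ p)))) ℕ.1+n≢0
  below-unique (onRight p) (onRight q) =
    parent-unique f (proj₁ (rightChild⁻ p)) (proj₁ (rightChild⁻ q))

  -- Lexicographic in (h , η), as η is at most n.
  key : Fin n → ℕ
  key v = h v * suc n + η v

  below-key : ∀ {y u} → Below y u → key u < key y
  below-key (onLeft p) = let (_ , uy) , e = leftChild⁻ p in sameLevel (kin-h f uy) e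
    where
    sameLevel : ∀ {a b d e} → a ≡ b → e ≡ suc d → a * suc n + d < b * suc n + e
    sameLevel {a} refl refl = ℕ.+-monoʳ-< (a * suc n) (ℕ.n<1+n _)
  below-key {u = u} (onRight p) = let (_ , hy) , e = rightChild⁻ p in nextLevel (η≤n f u) hy e
    where
    nextLevel : ∀ {a b d e} → d ≤ n → b ≡ suc a → e ≡ 1 → a * suc n + d < b * suc n + e
    nextLevel {a} {d = d} d≤n refl refl = begin-strict
      a * suc n + d       ≤⟨ ℕ.+-monoʳ-≤ (a * suc n) d≤n ⟩
      a * suc n + n       <⟨ ℕ.+-monoʳ-< (a * suc n) (ℕ.n<1+n n) ⟩
      a * suc n + suc n   ≡⟨ ℕ.+-comm (a * suc n) (suc n) ⟩
      suc a * suc n       ≤⟨ ℕ.m≤m+n _ 1 ⟩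
      suc a * suc n + 1   ∎
      where open ℕ.≤-Reasoning

  left≢right : ∀ {u a b} → leftChild f u ≡ just a → rightChild f u ≡ just b → a ≢ b
  left≢right p q refl = ℕ.1+n≢0 (ℕ.suc-injective
    (trans (sym (proj₂ (leftChild⁻ p))) (proj₂ (rightChild⁻ q))))

  -- Lexicographic induction on height and η: a vertex with η at least 2 is the left child of its
  -- previous sibling, one with η = 1 and positive height the right child of its parent, and one
  -- with η = 1 and height 0 the binary root.
  unfolds-complete : ∀ {t} → Unfolds (binaryRoot f) t → ∀ y → y ∈ labels t
  unfolds-complete {t} u y = go (h y) (length (smallerSiblings y)) refl refl
    where
    go : ∀ d e {y} → h y ≡ d → η y ≡ suc e → y ∈ labels t
    go zero zero hy ey = root∈labels (binaryRoot⁺ (h≡0⇒Root f hy) ey) u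
    go (suc d) zero hy ey = let p , py , hp , _ = parent-exists f hy in
      below∈labels (onRight (rightChild⁺ (py , trans hy (cong suc (sym hp))) ey)) u
        (go d _ hp refl)
    go d (suc e) hy ey = let x , xy , ex = previousSibling f ey in
      below∈labels (onLeft (leftChild⁺ xy ex)) u
        (go d e (trans (kin-h f (proj₂ xy)) hy) (ℕ.suc-injective (trans (sym ex) ey)))

  -- `us` collects the vertices of the branch above `mx`, so the depth left plus the depth used is
  -- always `n`. Running out of depth at some `just x` would give n+1 distinct vertices, as keys
  -- grow along the branch.
  binarySubtree-unfolds : ∀ m us → Unique us → length us + m ≡ n → ∀ mx →
    (∀ {x} → mx ≡ just x → All (λ u → key u < key x) us) →
    Unfolds mx (binarySubtree f m mx)
  binarySubtree-unfolds zero    _ _ _ nothing _ = empty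
  binarySubtree-unfolds (suc m) _ _ _ nothing _ = empty
  binarySubtree-unfolds zero us un len (just x) above =
    contradiction (unique⇒length≤ (x∉us ∷ un))
      (ℕ.<⇒≱ (s≤s (ℕ.≤-reflexive (trans (sym len) (ℕ.+-identityʳ _)))))
    where
    x∉us : All (x ≢_) us
    x∉us = All.map (λ lt → λ { refl → ℕ.n≮n _ lt }) (above refl)
  binarySubtree-unfolds (suc m) us un len (just x) above =
    branch (binarySubtree-unfolds m (x ∷ us) un′ len′ _ (above′ ∘ onLeft))
           (binarySubtree-unfolds m (x ∷ us) un′ len′ _ (above′ ∘ onRight))
    where
    un′ : Unique (x ∷ us)
    un′ = All.map (λ lt → λ { refl → ℕ.n≮n _ lt }) (above refl) ∷ un
    len′ : suc (length us) + m ≡ n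
    len′ = trans (sym (ℕ.+-suc (length us) m)) len
    above′ : ∀ {y} → Below y x → All (λ u → key u < key y) (x ∷ us)
    above′ b = below-key b ∷ All.map (λ lt → ℕ.<-trans lt (below-key b)) (above refl)

  binaryTree-unfolds : Unfolds (binaryRoot f) (binaryTree f)
  binaryTree-unfolds = binarySubtree-unfolds n [] [] refl _ (λ _ → [])

  labels-unique : Unique (labels (binaryTree f))
  labels-unique = unfolds-unique key below-key below-unique left≢right binaryTree-unfolds

  length-labels : length (labels (binaryTree f)) ≡ n
  length-labels = ℕ.≤-antisym (unique⇒length≤ (labels-unique))
    (subst (_≤ length (labels (binaryTree f))) (length-tabulate {n = n} (λ i → i))
      (unique-⊆⇒length≤ (Unique.allFin⁺ n) λ _ → unfolds-complete binaryTree-unfolds _))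

module _ {m n} (f : RF m) (g : RF n) (ι : Fin m → Fin n) where

  binaryRoot-map : (∀ {x} → BinaryRoot f x → BinaryRoot g (ι x)) →
                   (∀ {a} → BinaryRoot g a → ∃ λ x → BinaryRoot f x) →
                   binaryRoot g ≡ Maybe.map ι (binaryRoot f)
  binaryRoot-map = pick-map f g (binaryRoot? f) (binaryRoot? g) ι (binaryRoot-unique g)

  leftChild-map : ∀ {u v} → (∀ {x} → LeftChild f u x → LeftChild g v (ι x)) →
                  (∀ {a} → LeftChild g v a → ∃ λ x → LeftChild f u x) →
                  leftChild g v ≡ Maybe.map ι (leftChild f u)
  leftChild-map = pick-map f g (leftChild? f _) (leftChild? g _) ι (leftChild-unique g)

  rightChild-map : ∀ {u v} → (∀ {x} → RightChild f u x → RightChild g v (ι x)) →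
                   (∀ {a} → RightChild g v a → ∃ λ x → RightChild f u x) →
                   rightChild g v ≡ Maybe.map ι (rightChild f u)
  rightChild-map = pick-map f g (rightChild? f _) (rightChild? g _) ι (rightChild-unique g)

-- Equivalence of forests

⟨$⟩ʳ-injective : ∀ {n} (π : Permutation′ n) {x y} → π ⟨$⟩ʳ x ≡ π ⟨$⟩ʳ y → x ≡ y
⟨$⟩ʳ-injective π eq = trans (sym (inverseˡ π)) (trans (cong (π ⟨$⟩ˡ_) eq) (inverseˡ π))

∼-sym : ∀ {n} {f₁ f₂ : RF n} → f₁ ∼ f₂ → f₂ ∼ f₁
∼-sym {f₁ = f₁} {f₂} e = record
  { ψ = flip ψ
  ; ψ-edge = λ u v → mk⇔
      (Equivalence.from (ψ-edge _ _) ∘ subst₂ F₂._—_ (sym (inverseʳ ψ)) (sym (inverseʳ ψ)))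
      (subst₂ F₂._—_ (inverseʳ ψ) (inverseʳ ψ) ∘ Equivalence.to (ψ-edge _ _))
  ; ψ-h = λ v → trans (sym (ψ-h _)) (cong F₂.h (inverseʳ ψ))
  ; ψ-η = λ v → trans (sym (ψ-η _)) (cong F₂.η (inverseʳ ψ)) }
  where
  open _∼_ e
  module F₁ = RF f₁
  module F₂ = RF f₂

∼-trans : ∀ {n} {f₁ f₂ f₃ : RF n} → f₁ ∼ f₂ → f₂ ∼ f₃ → f₁ ∼ f₃
∼-trans e e′ = record
  { ψ = E.ψ ∘ₚ E′.ψ
  ; ψ-edge = λ u v → mk⇔
      (Equivalence.to (E′.ψ-edge _ _) ∘ Equivalence.to (E.ψ-edge _ _))
      (Equivalence.from (E.ψ-edge _ _) ∘ Equivalence.from (E′.ψ-edge _ _))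
  ; ψ-h = λ v → trans (E′.ψ-h _) (E.ψ-h v)
  ; ψ-η = λ v → trans (E′.ψ-η _) (E.ψ-η v) }
  where
  module E = _∼_ e
  module E′ = _∼_ e′

∼-refl : ∀ {n} {f : RF n} → f ∼ f
∼-refl = record { ψ = Perm.id ; ψ-edge = λ u v → mk⇔ (λ e → e) (λ e → e)
                ; ψ-h = λ v → refl ; ψ-η = λ v → refl }

module _ {n} {f₁ f₂ : RF n} (e : f₁ ∼ f₂) where
  open _∼_ e
  private
    module F₁ = RF f₁
    module F₂ = RF f₂

  -- `_∼_` does not mention roots; they are recovered as the vertices of height 0.
  ∼-root : ∀ {v} → F₁.Root v → F₂.Root (ψ ⟨$⟩ʳ v)
  ∼-root rv = h≡0⇒Root f₂ (trans (ψ-h _) (h-root f₁ rv))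

  ∼-parent : ∀ {v w} → F₁.Parent v w → F₂.Parent (ψ ⟨$⟩ʳ v) (ψ ⟨$⟩ʳ w)
  ∼-parent (vw , hw) = Equivalence.to (ψ-edge _ _) vw ,
    trans (ψ-h _) (trans hw (cong suc (sym (ψ-h _))))

  ∼-sibling : ∀ {v w} → F₁.Sibling v w → F₂.Sibling (ψ ⟨$⟩ʳ v) (ψ ⟨$⟩ʳ w)
  ∼-sibling (v≢w , kin) = v≢w ∘ ⟨$⟩ʳ-injective ψ ,
    Sum.map (λ (p , pv , pw) → _ , ∼-parent pv , ∼-parent pw)
            (λ (rv , rw) → ∼-root rv , ∼-root rw) kin

module _ {n} {f₁ f₂ : RF n} (e : f₁ ∼ f₂) where
  open _∼_ e
  private
    module F₁ = RF f₁
    module F₂ = RF f₂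

    ψʳ : Fin n → Fin n
    ψʳ = ψ ⟨$⟩ʳ_

  binaryRoot-∼ : binaryRoot f₂ ≡ Maybe.map ψʳ (binaryRoot f₁)
  binaryRoot-∼ = binaryRoot-map f₁ f₂ ψʳ
    (λ (rx , ex) → ∼-root e rx , trans (ψ-η _) ex)
    (λ (ry , ey) → _ , ∼-root (∼-sym e) ry , trans (_∼_.ψ-η (∼-sym e) _) ey)

  leftChild-∼ : ∀ v → leftChild f₂ (ψʳ v) ≡ Maybe.map ψʳ (leftChild f₁ v)
  leftChild-∼ v = leftChild-map f₁ f₂ ψʳ
    (λ (vx , ex) → ∼-sibling e vx , trans (ψ-η _) (trans ex (cong suc (sym (ψ-η _)))))
    (λ (vy , ey) → _ , subst (λ u → F₁.Sibling u _) (inverseˡ ψ) (∼-sibling (∼-sym e) vy)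
                     , trans (_∼_.ψ-η (∼-sym e) _) (trans ey (cong suc (ψ-η v))))

  rightChild-∼ : ∀ v → rightChild f₂ (ψʳ v) ≡ Maybe.map ψʳ (rightChild f₁ v)
  rightChild-∼ v = rightChild-map f₁ f₂ ψʳ
    (λ (vx , ex) → ∼-parent e vx , trans (ψ-η _) ex)
    (λ (vy , ey) → _ , subst (λ u → F₁.Parent u _) (inverseˡ ψ) (∼-parent (∼-sym e) vy)
                     , trans (_∼_.ψ-η (∼-sym e) _) ey)

  binarySubtree-∼ : ∀ m mx →
    binarySubtree f₂ m (Maybe.map ψʳ mx) ≡ mapₙ ψʳ (binarySubtree f₁ m mx)
  binarySubtree-∼ zero    nothing  = refl
  binarySubtree-∼ (suc m) nothing  = refl
  binarySubtree-∼ zero    (just v) = refl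
  binarySubtree-∼ (suc m) (just v) = cong₂ (λ l r → node l (ψʳ v) r)
    (trans (cong (binarySubtree f₂ m) (leftChild-∼ v)) (binarySubtree-∼ m (leftChild f₁ v)))
    (trans (cong (binarySubtree f₂ m) (rightChild-∼ v)) (binarySubtree-∼ m (rightChild f₁ v)))

  -- Siblings, parents and η determine the binary tree, so `ψ` carries one tree onto the other and
  -- merely permutes the coordinates. Here both trees have the same depth bound, and recursion on it
  -- works.
  φ-∼ : φ f₂ ↭ φ f₁
  φ-∼ = ψ , λ i → cong suc (begin
    rightsBefore (ψʳ i) (dyck (binaryTree f₂))
      ≡⟨ cong (rightsBefore (ψʳ i) ∘ dyck)
           (trans (cong (binarySubtree f₂ n) binaryRoot-∼) (binarySubtree-∼ n (binaryRoot f₁))) ⟩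
    rightsBefore (ψʳ i) (dyck (mapₙ ψʳ (binaryTree f₁)))
      ≡⟨ cong (rightsBefore (ψʳ i)) (dyck-map ψʳ (binaryTree f₁)) ⟩
    rightsBefore (ψʳ i) (List.map (mapStep ψʳ) (dyck (binaryTree f₁)))
      ≡⟨ rightsBefore-map ψʳ (⟨$⟩ʳ-injective ψ) i (dyck (binaryTree f₁)) ⟩
    rightsBefore i (dyck (binaryTree f₁)) ∎)
    where open ≡-Reasoning

-- Attaching a leaf

-- The label of `new` is left open, so that the record fits both attaching and deleting; `ι` is
-- monotone so that η can be preserved. Only graphs are involved, because the facts on walks are
-- used to prove that the deletion is a forest at all.
record PendantGraph {n} (F : Graph n) (G : Graph (suc n)) : Set where
  private
    module F = Graph F
    module G = Graph G
  field
    ι         : Fin n → Fin (suc n)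
    new       : Fin (suc n)
    stem      : Fin n
    ι-mono    : ∀ {x y} → x Fin.< y → ι x Fin.< ι y
    new≢ι     : ∀ {x} → new ≢ ι x
    cover     : ∀ a → a ≡ new ⊎ ∃ λ x → a ≡ ι x
    edge      : ∀ {x y} → (x F.— y) ⇔ (ι x G.— ι y)
    new-edge  : ι stem G.— new
    new-edge⁻ : ∀ {a} → a G.— new → a ≡ ι stem

  ι-reflects-< : ∀ {x y} → ι x Fin.< ι y → x Fin.< y
  ι-reflects-< {x} {y} lt with Fin.<-cmp x y
  ... | tri< x<y _ _  = x<y
  ... | tri≈ _ refl _ = contradiction lt (ℕ.n≮n _)
  ... | tri> _ _ y<x  = contradiction lt (ℕ.<⇒≯ (ι-mono y<x))

  ι-injective : ∀ {x y} → ι x ≡ ι y → x ≡ y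
  ι-injective {x} {y} eq with Fin.<-cmp x y
  ... | tri< x<y _ _  = contradiction eq (Fin.<⇒≢ (ι-mono x<y))
  ... | tri≈ _ x≡y _  = x≡y
  ... | tri> _ _ y<x  = contradiction (sym eq) (Fin.<⇒≢ (ι-mono y<x))

  lift : ∀ d {x y} → F.Walk d x y → G.Walk d (ι x) (ι y)
  lift zero    eq          = cong ι eq
  lift (suc d) (z , e , w) = ι z , Equivalence.to edge e , lift d w

  -- An excursion to `new` enters and leaves through `stem`, so it can be cut out, with `new` read
  -- as `stem`. That the walk does not get longer is what preserves heights.
  project : ∀ d {a x y} → a ≡ ι x ⊎ (a ≡ new × x ≡ stem) → G.Walk d a (ι y) →
            ∃ λ e → e ≤ d × F.Walk e x y
  project zero (inj₁ a≡ιx) w = 0 , z≤n , ι-injective (trans (sym a≡ιx) w)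
  project zero (inj₂ (a≡new , _)) w = contradiction (trans (sym a≡new) w) new≢ι
  project (suc d) (inj₁ refl) (b , e , w) with cover b
  ... | inj₁ refl =
    let d′ , d′≤ , w′ = project d (inj₂ (refl , ι-injective (new-edge⁻ e))) w
    in d′ , ℕ.m≤n⇒m≤1+n d′≤ , w′
  ... | inj₂ (z , refl) =
    let d′ , d′≤ , w′ = project d (inj₁ refl) w
    in suc d′ , s≤s d′≤ , z , Equivalence.from edge e , w′
  project (suc d) (inj₂ (refl , refl)) (b , e , w) =
    let d′ , d′≤ , w′ = project d (inj₁ (new-edge⁻ (G.—-sym e))) w
    in d′ , ℕ.m≤n⇒m≤1+n d′≤ , w′

record Pendant {n} (f : RF n) (g : RF (suc n)) : Set where
  private
    module F = RF f
    module G = RF g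
  field
    pendantGraph : PendantGraph F.graph G.graph
  open PendantGraph pendantGraph public
  field
    root     : ∀ {x} → F.Root x ⇔ G.Root (ι x)
    new-root : ¬ G.Root new

  rootOf-ι : ∀ x → G.rootOf (ι x) ≡ ι (F.rootOf x)
  rootOf-ι x = rootOf-unique g (Equivalence.to root (rootOf-root f x))
    (_ , lift _ (h-walk f x))

  h-ι : ∀ x → G.h (ι x) ≡ F.h x
  h-ι x = ℕ.≤-antisym
    (h-least g (ι x) (subst (G.Walk _ (ι x)) (sym (rootOf-ι x)) (lift _ (h-walk f x))))
    (let d , d≤ , w = project _ (inj₁ refl) (subst (G.Walk _ (ι x)) (rootOf-ι x) (h-walk g (ι x)))
     in ≤-trans (h-least f x w) d≤)

  h-new : G.h new ≡ suc (F.h stem)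
  h-new = go (G.h new) refl
    where
    go : ∀ d → G.h new ≡ d → G.h new ≡ suc (F.h stem)
    go zero    hn = contradiction (h≡0⇒Root g hn) new-root
    go (suc d) hn = let p , e , hp , _ = parent-exists g hn in
      trans hn (cong suc (trans (sym hp) (trans (cong G.h (new-edge⁻ e)) (h-ι stem))))

  parent-ι : ∀ {x y} → F.Parent x y → G.Parent (ι x) (ι y)
  parent-ι (xy , hy) = Equivalence.to edge xy ,
    trans (h-ι _) (trans hy (cong suc (sym (h-ι _))))

  parent-ι⁻ : ∀ {x y} → G.Parent (ι x) (ι y) → F.Parent x y
  parent-ι⁻ (xy , hy) = Equivalence.from edge xy ,
    trans (sym (h-ι _)) (trans hy (cong suc (h-ι _)))

  parent-new : G.Parent (ι stem) new
  parent-new = new-edge , trans h-new (cong suc (sym (h-ι stem)))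

  new-leaf : G.Leaf new
  new-leaf a (e , ha) = ℕ.<⇒≢ (s≤s (ℕ.n≤1+n _)) (begin
    F.h stem               ≡⟨ h-ι stem ⟨
    G.h (ι stem)           ≡⟨ cong G.h (new-edge⁻ (G.—-sym e)) ⟨
    G.h a                  ≡⟨ ha ⟩
    suc (G.h new)          ≡⟨ cong suc h-new ⟩
    suc (suc (F.h stem))   ∎)
    where open ≡-Reasoning

  parent-ι-ι⁻ : ∀ {a y} → G.Parent a (ι y) → ∃ λ x → a ≡ ι x × F.Parent x y
  parent-ι-ι⁻ {a} {y} ay = go (cover a) ay
    where
    go : ∀ {a} → a ≡ new ⊎ (∃ λ x → a ≡ ι x) → G.Parent a (ι y) → ∃ λ x → a ≡ ι x × F.Parent x y
    go (inj₁ refl)       ay = contradiction ay (new-leaf _)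
    go (inj₂ (x , refl)) ay = x , refl , parent-ι⁻ ay

  sibling-ι : ∀ {x y} → F.Sibling x y → G.Sibling (ι x) (ι y)
  sibling-ι (x≢y , kin) = x≢y ∘ ι-injective ,
    Sum.map (λ (p , px , py) → ι p , parent-ι px , parent-ι py)
            (λ (rx , ry) → Equivalence.to root rx , Equivalence.to root ry) kin

  sibling-ι⁻ : ∀ {x y} → G.Sibling (ι x) (ι y) → F.Sibling x y
  sibling-ι⁻ {x} {y} (x≢y , kin) = x≢y ∘ cong ι , Sum.map parents
    (λ (rx , ry) → Equivalence.from root rx , Equivalence.from root ry) kin
    where
    parents : (∃ λ p → G.Parent p (ι x) × G.Parent p (ι y)) → ∃ λ p → F.Parent p x × F.Parent p y
    parents (p , px , py) = let q , p≡ιq , qx = parent-ι-ι⁻ px in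
      q , qx , parent-ι⁻ (subst (λ p → G.Parent p (ι y)) p≡ιq py)

  module _ (stem-leaf : F.Leaf stem) where

    -- A sibling of `new` would be another child of `ι stem`, hence come from a child of the leaf
    -- `stem`. This is why the new label, whatever its size, shifts no value of η.
    new-no-sibling : ∀ {a} → ¬ G.Sibling new a
    new-no-sibling (_ , inj₂ (rn , _)) = new-root rn
    new-no-sibling {a} (new≢a , inj₁ (p , pn , pa)) =
      go (cover a) new≢a (subst (λ p → G.Parent p a) (new-edge⁻ (proj₁ pn)) pa)
      where
      go : ∀ {a} → a ≡ new ⊎ (∃ λ x → a ≡ ι x) → new ≢ a → ¬ G.Parent (ι stem) a
      go (inj₁ refl)       new≢a _  = new≢a refl
      go (inj₂ (x , refl)) _     pa = stem-leaf x (parent-ι⁻ pa)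

    η-new : G.η new ≡ 1
    η-new = η≡1 g λ s → contradiction s new-no-sibling

    sibling-ι-ι⁻ : ∀ {x a} → G.Sibling (ι x) a → ∃ λ y → a ≡ ι y × F.Sibling x y
    sibling-ι-ι⁻ {x} {a} s = go (cover a) s
      where
      go : ∀ {a} → a ≡ new ⊎ (∃ λ x → a ≡ ι x) → G.Sibling (ι x) a →
           ∃ λ y → a ≡ ι y × F.Sibling x y
      go (inj₁ refl)       s = contradiction (sibling-sym g s) new-no-sibling
      go (inj₂ (y , refl)) s = y , refl , sibling-ι⁻ s

    η-ι : ∀ x → G.η (ι x) ≡ F.η x
    η-ι x = cong suc (trans
      (ℕ.≤-antisym (unique-⊆⇒length≤ (smallerSiblings-unique g (ι x)) old)
                   (unique-⊆⇒length≤ (Unique.map⁺ ι-injective (smallerSiblings-unique f x)) new′))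
      (length-map ι (F.smallerSiblings x)))
      where
      old : G.smallerSiblings (ι x) ⊆ₗ List.map ι (F.smallerSiblings x)
      old a∈ = let s , a<ιx = ∈-smallerSiblings⁻ g a∈
                   y , a≡ιy , xy = sibling-ι-ι⁻ s
               in subst (_∈ List.map ι (F.smallerSiblings x)) (sym a≡ιy)
                    (∈-map⁺ ι (∈-smallerSiblings⁺ f xy
                      (ι-reflects-< (subst (Fin._< ι x) a≡ιy a<ιx))))
      new′ : List.map ι (F.smallerSiblings x) ⊆ₗ G.smallerSiblings (ι x)
      new′ a∈ = let y , y∈ , a≡ιy = ∈-map⁻ ι a∈
                    xy , y<x = ∈-smallerSiblings⁻ f y∈
                in subst (_∈ G.smallerSiblings (ι x)) (sym a≡ιy)
                     (∈-smallerSiblings⁺ g (sibling-ι xy) (ι-mono y<x))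

    -- As `new` is a leaf, the parent of an old vertex is old, so the path down to `ι x` stays in
    -- the image of `ι`.
    onFirstPath-ι⁻ : ∀ {a x} → a ≡ ι x → G.OnFirstPath a → F.OnFirstPath x
    onFirstPath-ι⁻ {x = x} refl (RF.start ra ea) =
      RF.start (Equivalence.from root ra) (trans (sym (η-ι x)) ea)
    onFirstPath-ι⁻ {x = x} refl (RF.step on vw ea) = let y , eq , yx = parent-ι-ι⁻ vw in
      RF.step (onFirstPath-ι⁻ eq on) yx (trans (sym (η-ι x)) ea)

    binaryRoot-ι : binaryRoot g ≡ Maybe.map ι (binaryRoot f)
    binaryRoot-ι = binaryRoot-map f g ι
      (λ (rx , ex) → Equivalence.to root rx , trans (η-ι _) ex)
      λ {a} (ra , ea) → go (cover a) ra ea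
      where
      go : ∀ {a} → a ≡ new ⊎ (∃ λ x → a ≡ ι x) → G.Root a → G.η a ≡ 1 →
           ∃ λ x → F.Root x × F.η x ≡ 1
      go (inj₁ refl)       ra _  = contradiction ra new-root
      go (inj₂ (x , refl)) ra ea = x , Equivalence.from root ra , trans (sym (η-ι x)) ea

    leftChild-ι : ∀ x → leftChild g (ι x) ≡ Maybe.map ι (leftChild f x)
    leftChild-ι x = leftChild-map f g ι
      (λ (xy , ey) → sibling-ι xy , trans (η-ι _) (trans ey (cong suc (sym (η-ι _)))))
      λ (s , ea) → let y , a≡ιy , xy = sibling-ι-ι⁻ s in
        y , xy , trans (sym (η-ι y)) (trans (cong G.η (sym a≡ιy)) (trans ea (cong suc (η-ι x))))

    -- At `stem`, and nowhere else, the new leaf changes a child of an old vertex in the binary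
    -- tree.
    rightChild-ι : ∀ {x} → x ≢ stem → rightChild g (ι x) ≡ Maybe.map ι (rightChild f x)
    rightChild-ι {x} x≢stem = rightChild-map f g ι
      (λ (xy , ey) → parent-ι xy , trans (η-ι _) ey)
      λ {a} (xa , ea) → go (cover a) xa ea
      where
      go : ∀ {a} → a ≡ new ⊎ (∃ λ y → a ≡ ι y) → G.Parent (ι x) a → G.η a ≡ 1 →
           ∃ λ y → F.Parent x y × F.η y ≡ 1
      go (inj₁ refl)       xa _  = contradiction (ι-injective (new-edge⁻ (proj₁ xa))) x≢stem
      go (inj₂ (y , refl)) xa ea = y , parent-ι⁻ xa , trans (sym (η-ι y)) ea

    rightChild-stem : rightChild g (ι stem) ≡ just new
    rightChild-stem = rightChild⁺ g parent-new η-new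

    leftChild-new : leftChild g new ≡ nothing
    leftChild-new = leftChild-nothing⁺ g new-no-sibling

    rightChild-new : rightChild g new ≡ nothing
    rightChild-new = rightChild-nothing⁺ g new-leaf

-- What `f ⁺` is to `f`, up to the choice of the label of the new leaf.
record Extension {n} (f : RF n) (g : RF (suc n)) : Set where
  private
    module F = RF f
    module G = RF g
    module UF = Unfolding (leftChild f) (rightChild f)
    module UG = Unfolding (leftChild g) (rightChild g)
  field
    pendant  : Pendant f g
  open Pendant pendant public
  field
    stem-end : F.EndOfFirstPath stem

  stem-leaf : F.Leaf stem
  stem-leaf = proj₂ stem-end

  stem-unique : ∀ {v} → F.EndOfFirstPath v → stem ≡ v
  stem-unique {v} end = trans (sym (unique stem-end)) (unique end)
    where
    instance
      n≢0 : NonZero n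
      n≢0 = Fin.nonZeroIndex v
    unique : ∀ {v} → F.EndOfFirstPath v → lastVertex f ≡ v
    unique = proj₂ (proj₂ (endOfFirstPath f))

  -- Right children of vertices on the first path stay on it, and the branch stops at a vertex
  -- without children, which must be `stem`.
  stem∈labels : ∀ {mx t v} → UF.Unfolds mx t → mx ≡ just v → F.OnFirstPath v → stem ∈ labels t
  stem∈labels (UF.branch {r = leaf _} ul ur) refl on =
    here (stem-unique (on , rightChild-nothing⁻ f (unfolds-leaf ur)))
  stem∈labels (UF.branch {l = l} {r = node _ x _} ul ur) refl on =
    let vx , ex = rightChild⁻ f (unfolds-node ur) in
    there (∈-++⁺ʳ (labels l) (stem∈labels ur (unfolds-node ur) (RF.step on vx ex)))

  unfolds-ι : ∀ {mx t} → UF.Unfolds mx t → stem ∉ labels t →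
              UG.Unfolds (Maybe.map ι mx) (mapₙ ι t)
  unfolds-ι UF.empty stem∉ = UG.empty
  unfolds-ι (UF.branch {v} {l} {r} ul ur) stem∉ = UG.branch
    (subst (λ m → UG.Unfolds m (mapₙ ι l)) (sym (leftChild-ι stem-leaf v))
      (unfolds-ι ul (stem∉ ∘ there ∘ ∈-++⁺ˡ)))
    (subst (λ m → UG.Unfolds m (mapₙ ι r)) (sym (rightChild-ι stem-leaf (stem∉ ∘ here ∘ sym)))
      (unfolds-ι ur (stem∉ ∘ there ∘ ∈-++⁺ʳ (labels l))))

  -- Since `stem` ends the rightmost branch and labels do not repeat, the left subtrees along that
  -- branch avoid `stem` and are copied unchanged. At the end of the branch `v` is `stem`, whose
  -- right child becomes the childless `new`.
  unfolds-graft : ∀ {mx t v} → UF.Unfolds mx t → mx ≡ just v → F.OnFirstPath v →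
                  Unique (labels t) → UG.Unfolds (Maybe.map ι mx) (graft (mapₙ ι t) new)
  unfolds-graft (UF.branch {v} {l} {leaf _} ul ur) refl on (v∉ ∷ _) = UG.branch
    (subst (λ m → UG.Unfolds m (mapₙ ι l)) (sym (leftChild-ι stem-leaf v)) (unfolds-ι ul stem∉l))
    (subst (λ m → UG.Unfolds m (node (leaf tt) new (leaf tt))) (sym stem-child) (UG.branch
      (subst (λ m → UG.Unfolds m (leaf tt)) (sym (leftChild-new stem-leaf)) UG.empty)
      (subst (λ m → UG.Unfolds m (leaf tt)) (sym (rightChild-new stem-leaf)) UG.empty)))
    where
    stem≡v : stem ≡ v
    stem≡v = stem-unique (on , rightChild-nothing⁻ f (unfolds-leaf ur))
    stem∉l : stem ∉ labels l
    stem∉l stem∈l = All.lookup v∉ (∈-++⁺ˡ stem∈l) (sym stem≡v)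
    stem-child : rightChild g (ι v) ≡ just new
    stem-child = trans (cong (rightChild g ∘ ι) (sym stem≡v)) (rightChild-stem stem-leaf)
  unfolds-graft (UF.branch {v} {l} {r@(node _ x _)} ul ur) refl on (v∉ ∷ un) = UG.branch
    (subst (λ m → UG.Unfolds m (mapₙ ι l)) (sym (leftChild-ι stem-leaf v))
      (unfolds-ι ul λ stem∈l → unique-++⇒disjoint (labels l) un stem∈l stem∈r))
    (subst (λ m → UG.Unfolds m (graft (mapₙ ι r) new))
      (sym (rightChild-ι stem-leaf λ v≡stem → All.lookup v∉ (∈-++⁺ʳ (labels l) stem∈r) v≡stem))
      (unfolds-graft ur (unfolds-node ur) onx (unique-++ˡ (labels l) un)))
    where
    onx : F.OnFirstPath x
    onx = let vx , ex = rightChild⁻ f (unfolds-node ur) in RF.step on vx ex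
    stem∈r : stem ∈ labels r
    stem∈r = stem∈labels ur (unfolds-node ur) onx

  -- Both sides unfold the binary root of `g`, so they agree although they were computed with
  -- different depth bounds.
  binaryTree-graft : binaryTree g ≡ graft (mapₙ ι (binaryTree f)) new
  binaryTree-graft = unfolds-functional (binaryTree-unfolds g)
    (subst (λ m → UG.Unfolds m (graft (mapₙ ι (binaryTree f)) new)) (sym (binaryRoot-ι stem-leaf))
      (let r , rr , er = firstRoot f in
       unfolds-graft (binaryTree-unfolds f) (binaryRoot⁺ f rr er) (RF.start rr er)
         (labels-unique f)))
    where
    instance
      n≢0 : NonZero n
      n≢0 = Fin.nonZeroIndex stem

  private
    t : Tree (Fin n) ⊤
    t = binaryTree f

  dyck-extension : dyck (binaryTree g) ≡ dyck (mapₙ ι t) ++ up new ∷ right ∷ []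
  dyck-extension = trans (cong dyck binaryTree-graft) (dyck-graft (mapₙ ι t) new)

  φ-ι : ∀ i → φ g (ι i) ≡ φ f i
  φ-ι i = cong suc (begin
    rightsBefore (ι i) (dyck (binaryTree g))
      ≡⟨ cong (rightsBefore (ι i)) dyck-extension ⟩
    rightsBefore (ι i) (dyck (mapₙ ι t) ++ up new ∷ right ∷ [])
      ≡⟨ rightsBefore-++ (ι i) (mapₙ ι t) _ (subst (ι i ∈_) (sym (labels-map ι t))
           (∈-map⁺ ι (unfolds-complete f (binaryTree-unfolds f) i))) ⟩
    rightsBefore (ι i) (dyck (mapₙ ι t))
      ≡⟨ cong (rightsBefore (ι i)) (dyck-map ι t) ⟩
    rightsBefore (ι i) (List.map (mapStep ι) (dyck t))
      ≡⟨ rightsBefore-map ι ι-injective i (dyck t) ⟩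
    rightsBefore i (dyck t) ∎)
    where open ≡-Reasoning

  φ-new : φ g new ≡ suc n
  φ-new = cong suc (begin
    rightsBefore new (dyck (binaryTree g))
      ≡⟨ cong (rightsBefore new) dyck-extension ⟩
    rightsBefore new (dyck (mapₙ ι t) ++ up new ∷ right ∷ [])
      ≡⟨ rightsBefore-∉ new (mapₙ ι t) _ new∉ ⟩
    length (labels (mapₙ ι t)) + rightsBefore new (up new ∷ right ∷ [])
      ≡⟨ cong₂ _+_
           (trans (cong length (labels-map ι t)) (trans (length-map ι (labels t)) (length-labels f)))
           (rightsBefore-here new _) ⟩
    n + 0
      ≡⟨ ℕ.+-identityʳ n ⟩
    n ∎)
    where
    open ≡-Reasoning
    new∉ : new ∉ labels (mapₙ ι t)
    new∉ new∈ = let _ , _ , eq = ∈-map⁻ ι (subst (new ∈_) (labels-map ι t) new∈) in new≢ι eq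

-- Uniqueness of extensions up to equivalence

module Relabel {n} {f : RF n} {g g′ : RF (suc n)} (E : Extension f g) (E′ : Extension f g′) where
  private
    module G = RF g
    module G′ = RF g′
    module E = Extension E
    module E′ = Extension E′

  relabelBy : ∀ {a} → a ≡ E.new ⊎ (∃ λ x → a ≡ E.ι x) → Fin (suc n)
  relabelBy (inj₁ _)       = E′.new
  relabelBy (inj₂ (x , _)) = E′.ι x

  relabel : Fin (suc n) → Fin (suc n)
  relabel a = relabelBy (E.cover a)

  relabel-new : relabel E.new ≡ E′.new
  relabel-new with E.cover E.new
  ... | inj₁ _        = refl
  ... | inj₂ (_ , eq) = contradiction eq E.new≢ι

  relabel-ι : ∀ x → relabel (E.ι x) ≡ E′.ι x
  relabel-ι x with E.cover (E.ι x)
  ... | inj₁ eq       = contradiction (sym eq) E.new≢ι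
  ... | inj₂ (_ , eq) = cong E′.ι (sym (E.ι-injective eq))

  relabel-invariant : (P : Fin (suc n) → Fin (suc n) → Set) →
                      P E.new E′.new → (∀ x → P (E.ι x) (E′.ι x)) → ∀ a → P a (relabel a)
  relabel-invariant P pn pι a with E.cover a
  ... | inj₁ refl       = pn
  ... | inj₂ (x , refl) = pι x

  stem≡ : E.stem ≡ E′.stem
  stem≡ = E.stem-unique E′.stem-end

  new-edge′ : ∀ {x} → E.ι x G.— E.new → E′.ι x G′.— E′.new
  new-edge′ e = subst (λ y → E′.ι y G′.— E′.new)
    (trans (sym stem≡) (E.ι-injective (sym (E.new-edge⁻ e)))) E′.new-edge

  relabel-edge : ∀ a b → a G.— b → relabel a G′.— relabel b
  relabel-edge = relabel-invariant (λ a a′ → ∀ b → a G.— b → a′ G′.— relabel b)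
    (relabel-invariant (λ b b′ → E.new G.— b → E′.new G′.— b′)
      (λ e → contradiction e G.—-irr)
      (λ x e → G′.—-sym (new-edge′ (G.—-sym e))))
    (λ x → relabel-invariant (λ b b′ → E.ι x G.— b → E′.ι x G′.— b′)
      new-edge′
      (λ y e → Equivalence.to E′.edge (Equivalence.from E.edge e)))

  relabel-h : ∀ a → G′.h (relabel a) ≡ G.h a
  relabel-h = relabel-invariant (λ a a′ → G′.h a′ ≡ G.h a)
    (trans E′.h-new (trans (cong (suc ∘ RF.h f) (sym stem≡)) (sym E.h-new)))
    (λ x → trans (E′.h-ι x) (sym (E.h-ι x)))

  relabel-η : ∀ a → G′.η (relabel a) ≡ G.η a
  relabel-η = relabel-invariant (λ a a′ → G′.η a′ ≡ G.η a)
    (trans (E′.η-new E′.stem-leaf) (sym (E.η-new E.stem-leaf)))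
    (λ x → trans (E′.η-ι E′.stem-leaf x) (sym (E.η-ι E.stem-leaf x)))

module _ {n} {f : RF n} {g g′ : RF (suc n)} (E : Extension f g) (E′ : Extension f g′) where
  private
    module R = Relabel E E′
    module R′ = Relabel E′ E

  relabel-inverse : ∀ a → R′.relabel (R.relabel a) ≡ a
  relabel-inverse = R.relabel-invariant (λ a a′ → R′.relabel a′ ≡ a) R′.relabel-new R′.relabel-ι

-- Edges, heights and η of an extension are all determined by `f`. The relabeling need not be
-- monotone, but it is monotone on the old vertices, and the new one has no siblings to be compared
-- with.
extension-unique : ∀ {n} {f : RF n} {g g′ : RF (suc n)} → Extension f g → Extension f g′ → g ∼ g′
extension-unique {g = g} E E′ = record
  { ψ = permutation R.relabel R′.relabel (relabel-inverse E′ E) (relabel-inverse E E′)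
  ; ψ-edge = λ a b → mk⇔ (R.relabel-edge a b)
      (subst₂ (RF._—_ g) (relabel-inverse E E′ a) (relabel-inverse E E′ b) ∘ R′.relabel-edge _ _)
  ; ψ-h = R.relabel-h
  ; ψ-η = R.relabel-η }
  where
  module R = Relabel E E′
  module R′ = Relabel E′ E

⁺-extension : ∀ {n} (f : RF n) .{{_ : NonZero n}} → Extension f (f ⁺)
⁺-extension {n} f = record
  { pendant = record
    { pendantGraph = record
      { ι = inject₁ ; new = fromℕ n ; stem = lastVertex f
      ; ι-mono = λ {x} {y} → subst₂ _<_ (sym (Fin.toℕ-inject₁ x)) (sym (Fin.toℕ-inject₁ y))
      ; new≢ι = Fin.fromℕ≢inject₁ ; cover = cover
      ; edge = mk⇔ A.old (A.old-inv refl refl) ; new-edge = A.down ; new-edge⁻ = A.new-inv refl }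
    ; root = mk⇔ A.old (root⁻ refl) ; new-root = new-root refl }
  ; stem-end = proj₁ (proj₂ (endOfFirstPath f)) }
  where
  module A = Attach f (lastVertex f)
  cover : ∀ a → a ≡ fromℕ n ⊎ ∃ λ x → a ≡ inject₁ x
  cover a with view a
  ... | ‵fromℕ     = inj₁ refl
  ... | ‵inject₁ x = inj₂ (x , refl)
  root⁻ : ∀ {a x} → a ≡ inject₁ x → A.IsRoot a → RF.Root f x
  root⁻ eq (A.old r) = subst (RF.Root f) (Fin.inject₁-injective eq) r
  new-root : ∀ {a} → a ≡ fromℕ n → ¬ A.IsRoot a
  new-root eq (A.old r) = Fin.fromℕ≢inject₁ (sym eq)

-- Deleting the end of the first path

module _ {n} (g : RF n) where
  open RF g
  private
    module UG = Unfolding (leftChild g) (rightChild g)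

  h-adjacent-≤ : ∀ {u v} → u — v → h u ≤ suc (h v)
  h-adjacent-≤ {u} {v} uv = h-least g u
    (v , uv , subst (Walk (h v) v) (sym (rootOf-adj g uv)) (h-walk g v))

  -- An edge inside a level would close a cycle: a triangle if the parents of its ends coincide, and
  -- otherwise a longer one through `level-path` between the parents. At height 0 both ends would be
  -- the same root.
  h-adjacent-≢ : ∀ {u v} → u — v → h u ≢ h v
  h-adjacent-≢ {u} {v} uv hu≡hv = go (h u) refl (sym hu≡hv)
    where
    ≢-above : ∀ {x y d} → h x ≡ suc d → h y ≤ d → x ≢ y
    ≢-above hx hy refl = ℕ.<⇒≱ (ℕ.≤-reflexive (sym hx)) hy
    u≢v : u ≢ v
    u≢v refl = —-irr uv
    cycle : ∀ {d p q} → h u ≡ suc d → h v ≡ suc d → p — u → q — v →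
            h p ≡ d → h q ≡ d → rootOf p ≡ rootOf q → ¬ h u ≡ h v
    cycle {d} {p} {q} hu hv pu qv hp hq same _ with p Fin.≟ q
    ... | yes refl = acyclic
      ((≢-above hu (ℕ.≤-reflexive hp) ∷ u≢v ∷ [])
        ∷ ((≢-above hv (ℕ.≤-reflexive hp) ∘ sym) ∷ []) ∷ [] ∷ [])
      (s≤s (s≤s z≤n)) (—-sym pu ∷ qv ∷ —-sym uv ∷ [-])
    ... | no p≢q with ws , l , un , lo ← level-path g d hp hq same p≢q = acyclic
      (All.∷ʳ⁺ (All.map (≢-above hu) lo) u≢v
        ∷ Unique-∷ʳ un (All.map (λ hy eq → ≢-above hv hy (sym eq)) lo))
      (s≤s (subst (1 ≤_) (sym (length-++ (ws ++ q ∷ []))) (ℕ.m≤n+m 1 _)))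
      (—-sym pu ∷ Linked-∷ʳ (p ∷ ws ++ q ∷ []) (Linked-∷ʳ (p ∷ ws) l qv) (—-sym uv))
    go : ∀ d → h u ≡ d → h v ≡ h u → ⊥
    go zero hu hv = u≢v (trans (h≡0⇒root g hu)
      (trans (rootOf-adj g uv) (sym (h≡0⇒root g (trans hv hu)))))
    go (suc d) hu hv =
      let p , pu , hp , rp = parent-exists g hu
          q , qv , hq , rq = parent-exists g (trans hv hu)
      in cycle hu (trans hv hu) pu qv hp hq (trans rp (trans (rootOf-adj g uv) (sym rq))) (sym hv)

  -- This turns a vertex without children into one whose only possible neighbour is its parent.
  parent-or-child : ∀ {u v} → u — v → Parent u v ⊎ Parent v u
  parent-or-child {u} {v} uv with ℕ.<-cmp (h u) (h v)
  ... | tri< hu<hv _ _ = inj₁ (uv , ℕ.≤-antisym (h-adjacent-≤ (—-sym uv)) hu<hv)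
  ... | tri≈ _ hu≡hv _ = contradiction hu≡hv (h-adjacent-≢ uv)
  ... | tri> _ _ hv<hu = inj₂ (—-sym uv , ℕ.≤-antisym (h-adjacent-≤ uv) hv<hu)

  -- Induction on the η of the sibling: stepping back through previous siblings must arrive at `v`,
  -- the only one with η = 1, and the sibling just before arrival would be the left child of `v`.
  leftChild-nothing⁻ : ∀ {v} → leftChild g v ≡ nothing → η v ≡ 1 → ∀ {w} → ¬ Sibling v w
  leftChild-nothing⁻ {v} eq ev {w} = go (length (smallerSiblings w)) refl
    where
    go : ∀ e {w} → η w ≡ suc e → ¬ Sibling v w
    go zero    ew (v≢w , vw) = v≢w (η≡1-unique g ev ew vw)
    go (suc e) {w} ew (v≢w , vw) = previous (previousSibling g ew)
      where
      previous : ¬ (∃ λ u → Sibling u w × η w ≡ suc (η u))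
      previous (u , uw , ewu) with v Fin.≟ u
      ... | yes refl = pick-nothing⁻ g (leftChild? g v) eq (uw , ewu)
      ... | no v≢u   = go e (ℕ.suc-injective (trans (sym ewu) ew))
                         (v≢u , kin-trans g vw (kin-sym g (proj₂ uw)))

  record LonelyEnd (w : Fin n) : Set where
    field
      {parent} : Fin n
      parent-onFirstPath : OnFirstPath parent
      isParent   : Parent parent w
      leaf-end   : Leaf w
      no-sibling : ∀ {x} → ¬ Sibling w x

  -- Being a right child gives `w` η = 1 and a parent on the first path. An empty left subtree then
  -- excludes siblings, an empty right subtree excludes children.
  endsIn⇒lonelyEnd : ∀ {v x r w} → OnFirstPath v → rightChild g v ≡ just x →
                     UG.Unfolds (just x) r → EndsIn w r → LonelyEnd w
  endsIn⇒lonelyEnd on vx (UG.branch ul ur) stop = record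
    { parent-onFirstPath = on
    ; isParent   = proj₁ (rightChild⁻ g vx)
    ; leaf-end   = rightChild-nothing⁻ g (unfolds-leaf ur)
    ; no-sibling = leftChild-nothing⁻ (unfolds-leaf ul) (proj₂ (rightChild⁻ g vx)) }
  endsIn⇒lonelyEnd on vx (UG.branch {r = r@(node _ _ _)} ul ur) (turn e) =
    endsIn⇒lonelyEnd (let vx , ex = rightChild⁻ g vx in RF.step on vx ex)
      (unfolds-node ur) (subst (λ m → UG.Unfolds m r) (unfolds-node ur) ur) e

maximalEntry⇒lonelyEnd : ∀ {n} .{{_ : NonZero n}} (g : RF (suc n)) {w} →
                         φ g w ≡ suc n → LonelyEnd g w
maximalEntry⇒lonelyEnd {n} g {w} eq =
  go (binaryTree-unfolds g) (length-labels g) (rightsBefore-maximal w (binaryTree g)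
    (unfolds-complete g (binaryTree-unfolds g) w) (trans eq (sym (length-labels g))))
  where
  module UG = Unfolding (leftChild g) (rightChild g)
  go : ∀ {t} → UG.Unfolds (binaryRoot g) t → length (labels t) ≡ suc n → EndsIn w t →
       LonelyEnd g w
  -- If `w` were the binary root, it would be the only label, against n+1 ≥ 2.
  go u len stop = contradiction (ℕ.suc-injective len) (ℕ.<⇒≢ (>-nonZero⁻¹ n))
  go u len (turn {l} {v} {r} e) = children u e
    where
    on : RF.OnFirstPath g v
    on = let rv , ev = binaryRoot⁻ g (unfolds-node u) in RF.start rv ev
    children : ∀ {mx l r} → UG.Unfolds mx (node l v r) → EndsIn w r → LonelyEnd g w
    children (UG.branch {r = r@(node _ _ _)} ul ur) e =
      endsIn⇒lonelyEnd g on (unfolds-node ur)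
        (subst (λ m → UG.Unfolds m r) (unfolds-node ur) ur) e

module Deletion {n} (g : RF (suc n)) {w : Fin (suc n)} (end : LonelyEnd g w) where
  open LonelyEnd end
  module G = RF g

  ι : Fin n → Fin (suc n)
  ι = punchIn w

  old : ∀ {a} → w ≢ a → ∃ λ x → a ≡ ι x
  old w≢a = Fin.punchOut w≢a , sym (Fin.punchIn-punchOut w≢a)

  cover : ∀ a → a ≡ w ⊎ ∃ λ x → a ≡ ι x
  cover a with w Fin.≟ a
  ... | yes w≡a = inj₁ (sym w≡a)
  ... | no w≢a  = inj₂ (old w≢a)

  w≢ι : ∀ {x} → w ≢ ι x
  w≢ι = Fin.punchInᵢ≢i w _ ∘ sym

  w-not-root : ¬ G.Root w
  w-not-root rw = root-no-parent g rw isParent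

  w≢parent : w ≢ parent
  w≢parent w≡p = G.—-irr (subst (G._— w) (sym w≡p) (proj₁ isParent))

  stem : Fin n
  stem = proj₁ (old w≢parent)

  parent≡ι : parent ≡ ι stem
  parent≡ι = proj₂ (old w≢parent)

  graph : Graph n
  graph = record
    { _—_ = λ x y → ι x G.— ι y ; _—?_ = λ x y → ι x G.—? ι y
    ; —-sym = G.—-sym ; —-irr = G.—-irr }

  module F = Graph graph

  pendantGraph : PendantGraph graph G.graph
  pendantGraph = record
    { ι = ι ; new = w ; stem = stem
    ; ι-mono = λ {x} {y} x<y → Fin.≤∧≢⇒< (Fin.punchIn-mono-≤ w x y (ℕ.<⇒≤ x<y))
        (Fin.<⇒≢ x<y ∘ Fin.punchIn-injective w x y)
    ; new≢ι = w≢ι ; cover = cover ; edge = mk⇔ (λ e → e) (λ e → e)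
    ; new-edge = subst (G._— w) parent≡ι (proj₁ isParent)
    -- A neighbour of `w` is its parent or a child, and `w` has no child.
    ; new-edge⁻ = λ e → trans
        ([ (λ aw → parent-unique g aw isParent) , (λ wa → contradiction wa (leaf-end _)) ]′
          (parent-or-child g e))
        parent≡ι }

  open PendantGraph pendantGraph using (lift; project; ι-injective)

  acyclic : F.Acyclic
  acyclic {v} {ws} un 2≤ l = G.acyclic (Unique.map⁺ ι-injective un)
    (subst (2 ≤_) (sym (length-map ι ws)) 2≤)
    (subst (Linked G._—_ ∘ (ι v ∷_)) (map-++ ι ws (v ∷ [])) (Linked.map⁺ l))

  -- The root reached in `g` is not `w`, so the walk to it can be contracted by `project` to avoid
  -- `w`. Conversely, walks of the deletion lift to `g`, which gives uniqueness.
  rooted : ∀ x → ∃! _≡_ λ r → G.Root (ι r) × F.Connected x r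
  rooted x =
    let r , rootOf≡ιr = old (λ w≡r → w-not-root (subst G.Root (sym w≡r) (rootOf-root g (ι x))))
        _ , _ , walk = project _ (inj₁ refl) (subst (G.Walk _ (ι x)) rootOf≡ιr (h-walk g (ι x)))
    in r , (subst G.Root rootOf≡ιr (rootOf-root g (ι x)) , _ , walk) ,
       λ (rr , d , walk′) →
         ι-injective (trans (sym rootOf≡ιr) (rootOf-unique g rr (d , lift d walk′)))

  deletion : RF n
  deletion = record
    { graph = graph ; Root = G.Root ∘ ι ; root? = G.root? ∘ ι
    ; acyclic = acyclic ; rooted = rooted }

  pendant : Pendant deletion g
  pendant = record
    { pendantGraph = pendantGraph ; root = mk⇔ (λ r → r) (λ r → r) ; new-root = w-not-root }

  open Pendant pendant using (parent-ι; onFirstPath-ι⁻)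

  -- A remaining child of `stem` would be a sibling of `w` in `g`.
  stem-leaf : RF.Leaf deletion stem
  stem-leaf x sx = no-sibling
    (w≢ι , inj₁ (parent , isParent , subst (λ p → G.Parent p (ι x)) (sym parent≡ι) (parent-ι sx)))

  deletion-extension : Extension deletion g
  deletion-extension = record
    { pendant = pendant
    ; stem-end = onFirstPath-ι⁻ stem-leaf parent≡ι parent-onFirstPath , stem-leaf }

-- Parking functions

entry-resp-↭⁺ : ∀ {n k} {a b : Vector ℕ n} → a ↭ b → Entry k b → Entry k a
entry-resp-↭⁺ (ρ , eq) (i , bi) = ρ ⟨$⟩ʳ i , trans (eq i) bi

entry-resp-↭⁻ : ∀ {n k} {a b : Vector ℕ n} → a ↭ b → Entry k a → Entry k b
entry-resp-↭⁻ {a = a} (ρ , eq) (i , ai) =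
  ρ ⟨$⟩ˡ i , trans (sym (eq _)) (trans (cong a (inverseʳ ρ)) ai)

PF-resp-↭ : ∀ {n} {a b : Vector ℕ n} → a ↭ b → PF n b → PF n a
PF-resp-↭ {a = a} (ρ , eq) (pos , c , (σ , eq′) , sorted , bounds) =
  (λ i → subst (1 ≤_) (trans (sym (eq _)) (cong a (inverseʳ ρ))) (pos (ρ ⟨$⟩ˡ i))) ,
  c , (σ ∘ₚ ρ , λ i → trans (eq _) (eq′ i)) , sorted , bounds

PFₖ-resp-↭ : ∀ {n k} {a b : Vector ℕ n} → a ↭ b → PFₖ n k b → PFₖ n k a
PFₖ-resp-↭ {a = a} {b} a↭b (pf , ¬k , later) =
  PF-resp-↭ {a = a} {b} a↭b pf ,
  ¬k ∘ entry-resp-↭⁻ {a = a} {b} a↭b ,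
  λ j k<j j≤n → entry-resp-↭⁺ {a = a} {b} a↭b (later j k<j j≤n)

RFₖ-∼ : ∀ {n} k {f₁ f₂ : RF n} → f₁ ∼ f₂ → RFₖ n k f₁ → RFₖ n k f₂
RFₖ-∼ 0             {f₁} {f₂} e p = PFₖ-resp-↭ {a = φ f₂} {φ f₁} (φ-∼ e) p
RFₖ-∼ 1             {f₁} {f₂} e (σ , eq) =
  let ρ , eq′ = φ-∼ e in σ ∘ₚ ρ , λ i → trans (eq′ _) (eq i)
RFₖ-∼ (suc (suc k)) {f₁} {f₂} e p = PFₖ-resp-↭ {a = φ f₂} {φ f₁} (φ-∼ e) p

-- Appending and removing a last coordinate

punchIn-fromℕ : ∀ {n} (i : Fin n) → punchIn (fromℕ n) i ≡ inject₁ i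
punchIn-fromℕ zero    = refl
punchIn-fromℕ (suc i) = cong suc (punchIn-fromℕ i)

module _ {n} {a b : Vector ℕ (suc n)} where

  ↭-init⁺ : (a ∘ inject₁) ↭ (b ∘ inject₁) → a (fromℕ n) ≡ b (fromℕ n) → a ↭ b
  ↭-init⁺ (ρ , eq) top = ρ′ , go
    where
    ρ′ : Permutation′ (suc n)
    ρ′ = insert (fromℕ n) (fromℕ n) ρ
    ρ′-top : ρ′ ⟨$⟩ʳ fromℕ n ≡ fromℕ n
    ρ′-top with fromℕ n Fin.≟ fromℕ n
    ... | yes _ = refl
    ... | no ≢  = contradiction refl ≢
    go : ∀ i → a (ρ′ ⟨$⟩ʳ i) ≡ b i
    go i with view i
    ... | ‵fromℕ = trans (cong a ρ′-top) top
    ... | ‵inject₁ x = trans (cong a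
      (trans (cong (ρ′ ⟨$⟩ʳ_) (sym (punchIn-fromℕ x)))
        (trans (insert-punchIn (fromℕ n) (fromℕ n) ρ x) (punchIn-fromℕ _)))) (eq x)

  -- A transposition makes the permutation fix the last index.
  ↭-init⁻ : a ↭ b → a (fromℕ n) ≡ b (fromℕ n) → (a ∘ inject₁) ↭ (b ∘ inject₁)
  ↭-init⁻ (ρ , eq) top = remove (fromℕ n) ρ′ , λ i → begin
    a (inject₁ (remove (fromℕ n) ρ′ ⟨$⟩ʳ i))
      ≡⟨ cong a (punchIn-fromℕ _) ⟨
    a (punchIn (fromℕ n) (remove (fromℕ n) ρ′ ⟨$⟩ʳ i))
      ≡⟨ cong (λ t → a (punchIn t (remove (fromℕ n) ρ′ ⟨$⟩ʳ i))) ρ′-top ⟨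
    a (punchIn (ρ′ ⟨$⟩ʳ fromℕ n) (remove (fromℕ n) ρ′ ⟨$⟩ʳ i))
      ≡⟨ cong a (punchIn-permute ρ′ (fromℕ n) i) ⟨
    a (ρ′ ⟨$⟩ʳ punchIn (fromℕ n) i)
      ≡⟨ a-swap _ ⟩
    a (ρ ⟨$⟩ʳ punchIn (fromℕ n) i)
      ≡⟨ eq _ ⟩
    b (punchIn (fromℕ n) i)
      ≡⟨ cong b (punchIn-fromℕ i) ⟩
    b (inject₁ i) ∎
    where
    open ≡-Reasoning
    j : Fin (suc n)
    j = ρ ⟨$⟩ʳ fromℕ n
    ρ′ : Permutation′ (suc n)
    ρ′ = ρ ∘ₚ transpose j (fromℕ n)
    ρ′-top : ρ′ ⟨$⟩ʳ fromℕ n ≡ fromℕ n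
    ρ′-top with j Fin.≟ j
    ... | yes _ = refl
    ... | no ≢  = contradiction refl ≢
    a-swap : ∀ y → a (transpose j (fromℕ n) ⟨$⟩ʳ y) ≡ a y
    a-swap y with y Fin.≟ j
    ... | yes refl = trans top (sym (eq (fromℕ n)))
    ... | no _ with y Fin.≟ fromℕ n
    ...   | yes refl = trans (eq (fromℕ n)) (sym top)
    ...   | no _     = refl

snoc : ∀ {n} → Vector ℕ n → ℕ → Vector ℕ (suc n)
snoc b c i with view i
... | ‵inject₁ x = b x
... | ‵fromℕ     = c

module _ {n} (b : Vector ℕ n) (c : ℕ) where

  snoc-inject₁ : ∀ i → snoc b c (inject₁ i) ≡ b i
  snoc-inject₁ i rewrite view-inject₁ i = refl

  snoc-fromℕ : snoc b c (fromℕ n) ≡ c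
  snoc-fromℕ rewrite view-fromℕ n = refl

module _ {n} {a : Vector ℕ n} {c : Vector ℕ (suc n)}
         (c-init : ∀ i → c (inject₁ i) ≡ a i) (c-top : c (fromℕ n) ≡ suc n) where

  PF-snoc⁺ : PF n a → PF (suc n) c
  PF-snoc⁺ (pos , b , (ρ , eq) , sorted , bounds) =
    pos′ , snoc b (suc n) ,
    ↭-init⁺ {a = c} {snoc b (suc n)}
      (ρ , λ i → trans (c-init _) (trans (eq i) (sym (snoc-inject₁ b (suc n) i))))
      (trans c-top (sym (snoc-fromℕ b (suc n)))) ,
    sorted′ , bounds′
    where
    pos′ : ∀ i → 1 ≤ c i
    pos′ i with view i
    ... | ‵inject₁ x = subst (1 ≤_) (sym (c-init x)) (pos x)
    ... | ‵fromℕ     = subst (1 ≤_) (sym c-top) (s≤s z≤n)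
    sorted′ : ∀ {i j} → i Fin.≤ j → snoc b (suc n) i ≤ snoc b (suc n) j
    sorted′ {i} {j} i≤j with view i | view j
    ... | ‵inject₁ x | ‵inject₁ y = sorted (subst₂ _≤_ (Fin.toℕ-inject₁ x) (Fin.toℕ-inject₁ y) i≤j)
    -- The appended n+1 exceeds every entry, because the entry at position x is bounded by its
    -- position.
    ... | ‵inject₁ x | ‵fromℕ     = ≤-trans (bounds x) (s≤s (ℕ.<⇒≤ (Fin.toℕ<n x)))
    ... | ‵fromℕ     | ‵inject₁ y = contradiction
      (subst₂ _≤_ (Fin.toℕ-fromℕ n) (Fin.toℕ-inject₁ y) i≤j) (ℕ.<⇒≱ (Fin.toℕ<n y))
    ... | ‵fromℕ     | ‵fromℕ     = ℕ.≤-refl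
    bounds′ : ∀ i → snoc b (suc n) i ≤ suc (toℕ i)
    bounds′ i with view i
    ... | ‵inject₁ x = subst (λ m → b x ≤ suc m) (sym (Fin.toℕ-inject₁ x)) (bounds x)
    ... | ‵fromℕ     = s≤s (ℕ.≤-reflexive (sym (Fin.toℕ-fromℕ n)))

  PF-snoc⁻ : PF (suc n) c → PF n a
  PF-snoc⁻ (pos , b , c↭b@(ρ , eq) , sorted , bounds) =
    (λ i → subst (1 ≤_) (c-init i) (pos (inject₁ i))) ,
    b ∘ inject₁ ,
    (proj₁ init , λ i → trans (sym (c-init _)) (proj₂ init i)) ,
    (λ {i} {j} i≤j → sorted (subst₂ _≤_ (sym (Fin.toℕ-inject₁ i)) (sym (Fin.toℕ-inject₁ j)) i≤j)) ,
    λ i → subst (λ m → b (inject₁ i) ≤ suc m) (Fin.toℕ-inject₁ i) (bounds (inject₁ i))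
    where
    b-top : c (fromℕ n) ≡ b (fromℕ n)
    b-top = ℕ.≤-antisym
      (subst (_≤ b (fromℕ n)) (trans (sym (eq _)) (cong c (inverseʳ ρ)))
        (sorted (Fin.≤fromℕ (ρ ⟨$⟩ˡ fromℕ n))))
      (subst (b (fromℕ n) ≤_) (trans (cong suc (Fin.toℕ-fromℕ n)) (sym c-top)) (bounds (fromℕ n)))
    init : (c ∘ inject₁) ↭ (b ∘ inject₁)
    init = ↭-init⁻ {a = c} {b} c↭b b-top

  PFₖ-snoc⁺ : ∀ {k} → k ≤ n → PFₖ n k a → PFₖ (suc n) k c
  PFₖ-snoc⁺ {k} k≤n (pf , ¬k , later) = PF-snoc⁺ pf , ¬k′ , later′
    where
    ¬k′ : ¬ Entry k c
    ¬k′ (i , ci) with view i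
    ... | ‵inject₁ x = ¬k (x , trans (sym (c-init x)) ci)
    -- The appended entry n+1 differs from k because k ≤ n.
    ... | ‵fromℕ     = ℕ.<⇒≢ (s≤s k≤n) (trans (sym ci) c-top)
    later′ : ∀ j → k < j → j ≤ suc n → Entry j c
    later′ j k<j j≤1+n with j ≟ suc n
    ... | yes refl = fromℕ n , c-top
    ... | no j≢ with i , ai ← later j k<j (s≤s⁻¹ (ℕ.≤∧≢⇒< j≤1+n j≢)) =
      inject₁ i , trans (c-init i) ai

  PFₖ-snoc⁻ : ∀ {k} → PFₖ (suc n) k c → PFₖ n k a
  PFₖ-snoc⁻ {k} (pf , ¬k , later) =
    PF-snoc⁻ pf , (λ (i , ai) → ¬k (inject₁ i , trans (c-init i) ai)) , later′
    where
    later′ : ∀ j → k < j → j ≤ n → Entry j a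
    later′ j k<j j≤n with i , ci ← later j k<j (ℕ.m≤n⇒m≤1+n j≤n) with view i
    ... | ‵inject₁ x = x , trans (sym (c-init x)) ci
    ... | ‵fromℕ     = contradiction (trans (sym ci) c-top) (ℕ.<⇒≢ (s≤s j≤n))

  isPermutation-snoc⁺ : IsPermutation a → IsPermutation c
  isPermutation-snoc⁺ (ρ , eq) = ↭-init⁺ {a = c}
    (ρ , λ i → trans (c-init _) (trans (eq i) (cong suc (sym (Fin.toℕ-inject₁ i)))))
    (trans c-top (cong suc (sym (Fin.toℕ-fromℕ n))))

  isPermutation-snoc⁻ : IsPermutation c → IsPermutation a
  isPermutation-snoc⁻ c↭
    with ρ , eq ← ↭-init⁻ {a = c} c↭ (trans c-top (cong suc (sym (Fin.toℕ-fromℕ n)))) =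
    ρ , λ i → trans (sym (c-init _)) (trans (eq i) (cong suc (Fin.toℕ-inject₁ i)))

-- Transfer to sets of forests, and the theorem

RFₖ-snoc : ∀ {n} k → k ≤ n → (f : RF n) (g : RF (suc n)) →
           (∀ i → φ g (inject₁ i) ≡ φ f i) → φ g (fromℕ n) ≡ suc n →
           RFₖ n k f ⇔ RFₖ (suc n) k g
RFₖ-snoc 0 k≤n f g i t =
  mk⇔ (PFₖ-snoc⁺ {a = φ f} {φ g} i t k≤n) (PFₖ-snoc⁻ {a = φ f} {φ g} i t)
RFₖ-snoc 1 k≤n f g i t =
  mk⇔ (isPermutation-snoc⁺ {a = φ f} {φ g} i t) (isPermutation-snoc⁻ {a = φ f} {φ g} i t)
RFₖ-snoc (suc (suc k)) k≤n f g i t =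
  mk⇔ (PFₖ-snoc⁺ {a = φ f} {φ g} i t k≤n) (PFₖ-snoc⁻ {a = φ f} {φ g} i t)

-- As k < n+1, the value n+1 belongs to the range of entries required by `PFₖ`; for k = 1 a
-- permutation contains it anyway.
RFₖ⇒maximalEntry : ∀ {n} k → k ≤ n → (g : RF (suc n)) → RFₖ (suc n) k g → Entry (suc n) (φ g)
RFₖ⇒maximalEntry     0             k≤n g (_ , _ , later) = later _ (s≤s k≤n) ℕ.≤-refl
RFₖ⇒maximalEntry {n} 1             k≤n g (ρ , eq) =
  ρ ⟨$⟩ʳ fromℕ n , trans (eq (fromℕ n)) (cong suc (Fin.toℕ-fromℕ n))
RFₖ⇒maximalEntry     (suc (suc k)) k≤n g (_ , _ , later) = later _ (s≤s k≤n) ℕ.≤-refl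

proposition4p12 : ∀ n k (1≤k : 1 ≤ k) (k≤n : k ≤ n) →
    let instance nonZero = >-nonZero (≤-trans 1≤k k≤n) in
    ∀ (g : RF (suc n)) →
    (Class g ⊆ RFₖ (suc n) k) ⇔ (∃ λ (f : RF n) → RFₖ n k f × Class g ≐ Class (f ⁺))
proposition4p12 n k 1≤k k≤n g = mk⇔ restrict extend
  where
  instance
    n≢0 : NonZero n
    n≢0 = >-nonZero (≤-trans 1≤k k≤n)

  RFₖ-⁺ : ∀ f → RFₖ n k f ⇔ RFₖ (suc n) k (f ⁺)
  RFₖ-⁺ f = RFₖ-snoc k k≤n f (f ⁺) E.φ-ι E.φ-new
    where module E = Extension (⁺-extension f)

  restrict : Class g ⊆ RFₖ (suc n) k → ∃ λ (f : RF n) → RFₖ n k f × Class g ≐ Class (f ⁺)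
  restrict classes =
    f , Equivalence.from (RFₖ-⁺ f) (RFₖ-∼ k g∼f⁺ (classes ∼-refl)) ,
    ∼-trans (∼-sym g∼f⁺) , ∼-trans g∼f⁺
    where
    entry : Entry (suc n) (φ g)
    entry = RFₖ⇒maximalEntry k k≤n g (classes ∼-refl)
    module D = Deletion g (maximalEntry⇒lonelyEnd g (proj₂ entry))
    f : RF n
    f = D.deletion
    g∼f⁺ : g ∼ f ⁺
    -- The deleted vertex may have carried any label in `g`, while the leaf of `f ⁺` carries the
    -- largest; both forests still extend `f`.
    g∼f⁺ = extension-unique D.deletion-extension (⁺-extension f)

  extend : (∃ λ (f : RF n) → RFₖ n k f × Class g ≐ Class (f ⁺)) → Class g ⊆ RFₖ (suc n) k
  extend (f , rf , same , _) g∼x = RFₖ-∼ k (same g∼x) (Equivalence.to (RFₖ-⁺ f) rf)
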